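{- For positive integers $m,n$, the number of ternary (strong) lonesum $m\times n$ matrices equals $$1+\sum_{j=1}^{\min(m,n)}\ \sum_{\substack{(m_0,m_1,\ldots,m_j)\in\mathcal{S}_m^j\\ (n_0,n_1,\ldots,n_j)\in\mathcal{S}_n^j}} \binom{m}{m_0,m_1,\ldots,m_j}\binom{n}{n_0,n_1,\ldots,n_j}\prod_{i=1}^{j} f_3(m_i,n_{j+1-i}),$$ where $f_3(r,s)=1+rs+r(2^{s}-s-1)+s(2^{r}-r-1)$.
   Context: A ternary matrix has entries in $\{0,1,2\}$. A ternary $m\times n$ matrix $M$ is a (strong) lonesum matrix if it is the only ternary $m\times n$ matrix with the same row sums and the same column sums as $M$. For integers $j\ge 1$, $l\ge 1$, $\mathcal{S}_l^j=\{(l_0,l_1,\ldots,l_j)\in\mathbb{Z}^{j+1} : \sum_{i=0}^j l_i=l,\ l_0\ge 0,\ l_i\ge 1 \text{ for } 1\le i\le j\}$. $\binom{m}{m_0,\ldots,m_j}$ denotes the multinomial coefficient. -}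

module Defs where

open import Data.Nat using (ℕ; zero; suc; _+_; _*_; _∸_; _^_; _≤_; _≤ᵇ_; _/_; NonZero; _⊓_; _!)
open import Data.Nat.Properties using (m*n≢0; _!≢0)
open import Data.Fin using (Fin; toℕ)
open import Data.Vec using (Vec; []; _∷_; map; transpose; zipWith; reverse; foldr)
open import Data.List using (List; concatMap; filterᵇ; upTo)
open import Data.Bool using (Bool; true; false; _∧_)
open import Data.List.Relation.Unary.Unique.Propositional using (Unique)
open import Data.List.Membership.Propositional using (_∈_)
open import Data.Product using (Σ; _×_)
open import Function.Bundles using (_⇔_)
open import Relation.Binary.PropositionalEquality using (_≡_)

TMatrix : ℕ → ℕ → Set
TMatrix m n = Vec (Vec (Fin 3) n) m

vsum : ∀ {k} → Vec ℕ k → ℕ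
vsum = foldr _ _+_ 0

rowSums : ∀ {m n} → TMatrix m n → Vec ℕ m
rowSums M = map (λ row → vsum (map toℕ row)) M

colSums : ∀ {m n} → TMatrix m n → Vec ℕ n
colSums M = rowSums (transpose M)

IsLonesum : ∀ {m n} → TMatrix m n → Set
IsLonesum {m} {n} M =
  (N : TMatrix m n) → rowSums N ≡ rowSums M → colSums N ≡ colSums M → N ≡ M

HasCount : {A : Set} → (A → Set) → ℕ → Set
HasCount {A} P k =
  Σ (List A) (λ L → Unique L × ((x : A) → (x ∈ L) ⇔ P x) × (Data.List.length L ≡ k))
  where import Data.List

lsum : List ℕ → ℕ
lsum = Data.List.foldr _+_ 0

vprod : ∀ {k} → Vec ℕ k → ℕ
vprod = foldr _ _*_ 1

allVecs : (l k : ℕ) → List (Vec ℕ k)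
allVecs l zero    = Data.List.[ [] ]
allVecs l (suc k) = concatMap (λ x → Data.List.map (x ∷_) (allVecs l k)) (upTo (suc l))

allPos : ∀ {k} → Vec ℕ k → Bool
allPos []       = true
allPos (x ∷ xs) = (1 ≤ᵇ x) ∧ allPos xs

isS : (l : ℕ) → ∀ {k} → Vec ℕ (suc k) → Bool
isS l (x ∷ xs) = allPos xs ∧ ((vsum (x ∷ xs) ≤ᵇ l) ∧ (l ≤ᵇ vsum (x ∷ xs)))

S : (l j : ℕ) → List (Vec ℕ (suc j))
S l j = filterᵇ (isS l) (allVecs l (suc j))

factProd : ∀ {k} → Vec ℕ k → ℕ
factProd v = vprod (map (λ x → x !) v)

factProd≢0 : ∀ {k} (v : Vec ℕ k) → NonZero (factProd v)
factProd≢0 []       = _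
factProd≢0 (x ∷ xs) = m*n≢0 (x !) (factProd xs) {{x !≢0}} {{factProd≢0 xs}}

multinomial : (m : ℕ) → ∀ {k} → Vec ℕ k → ℕ
multinomial m v = (m ! / factProd v) {{factProd≢0 v}}

f3 : ℕ → ℕ → ℕ
f3 r s = 1 + r * s + r * (2 ^ s ∸ s ∸ 1) + s * (2 ^ r ∸ r ∸ 1)

prodTerm : ∀ {j} → Vec ℕ (suc j) → Vec ℕ (suc j) → ℕ
prodTerm (_ ∷ ms) (_ ∷ ns) = vprod (zipWith f3 ms (reverse ns))

term : (m n j : ℕ) → ℕ
term m n j =
  lsum (concatMap (λ ms → Data.List.map (λ ns →
      multinomial m ms * multinomial n ns * prodTerm ms ns) (S n j)) (S m j))

lonesumFormula : ℕ → ℕ → ℕ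
lonesumFormula m n = 1 + lsum (Data.List.map (λ i → term m n (suc i)) (upTo (m ⊓ n)))

{-# OPTIONS --safe #-}

-- A matrix is lonesum exactly when it has no switch: two cells with positive entries, in different
-- rows and columns, whose two opposite corners are both below 2.  In a switch-free matrix the
-- supports of the rows form a chain, so rows and columns split into ordered blocks: an entry is 0
-- below the staircase, 2 above it, and only the diagonal blocks can contain a 1.  The 1s of a
-- diagonal block occupy the intersection of some marked rows with some marked columns, and switch-
-- freeness says that either nothing is marked or both numbers are positive with one of them equal
-- to 1.  An r × s block thus has f3 r s = Σ C(r,a) C(s,b) fillings, summed over the admissible (a ,
-- b), and the multinomial coefficients count the assignments of rows and columns to blocks.
module Submission where

open import Defs
open import Data.Nat using (ℕ; zero; suc; _+_; _*_; _∸_; _^_; _≤_; _<_; _≤ᵇ_; _⊓_; _⊔_; z≤n; s≤s; s≤s⁻¹; z<s; _<?_; _≤?_; _≟_; _!; NonZero)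
open import Data.Nat.Properties
open import Data.Nat.Induction using (<-wellFounded)
open import Data.Nat.Combinatorics using (_C_; nCk≡n!/k![n-k]!; k![n∸k]!∣n!; nCk+nC[k+1]≡[n+1]C[k+1]; k>n⇒nCk≡0)
open import Data.Nat.DivMod using (m*n/n≡m; m/n*n≡m)
open import Data.Nat.Tactic.RingSolver using (solve-∀)
open import Induction.WellFounded using (Acc; acc)
open import Data.Fin using (Fin; zero; suc; toℕ; fromℕ; fromℕ<; inject₁; opposite)
import Data.Fin.Properties as Fin
open import Data.Bool using (Bool; true; false; T; _∧_)
open import Data.Bool.Properties using (T-∧)
open import Data.List using (List; []; _∷_; _++_; concatMap; filterᵇ; upTo; allFin; length)
import Data.List as List
import Data.List.Properties as List
open import Data.List.Membership.Propositional using (_∈_; find; lose)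
open import Data.List.Membership.Propositional.Properties using (∈-map⁺; ∈-map⁻; ∈-concatMap⁺; ∈-concatMap⁻; ∈-filter⁺; ∈-filter⁻; ∈-upTo⁺; ∈-allFin)
open import Data.List.Relation.Unary.All as All using (All; []; _∷_)
import Data.List.Relation.Unary.All.Properties as All
open import Data.List.Relation.Unary.Any using (here; there)
open import Data.List.Relation.Unary.AllPairs using ([]; _∷_)
open import Data.List.Relation.Unary.Unique.Propositional using (Unique)
import Data.List.Relation.Unary.Unique.Propositional.Properties as Unique
open import Data.Vec using (Vec; []; _∷_; map; zipWith; replicate; lookup; tabulate; updateAt; transpose; _⊛_; reverse; _∷ʳ_; head; tail; foldr)
import Data.Vec.Properties as Vec
open import Data.Product using (Σ; ∃-syntax; _×_; _,_; proj₁; proj₂)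
open import Data.Sum using (_⊎_; inj₁; inj₂)
open import Data.Empty using (⊥; ⊥-elim)
open import Data.Unit using (tt)
open import Function using (_∘_; id; flip)
open import Function.Bundles using (mk⇔; Equivalence)
open import Relation.Nullary using (¬_; Dec; yes; no; contradiction)
open import Relation.Nullary.Decidable using (⌊_⌋; toWitness; fromWitness; T?)
open import Relation.Binary.Definitions using (tri<; tri≈; tri>)
open import Relation.Binary.PropositionalEquality

private variable
  A B : Set
  j k m n : ℕ

-- Lonesum matrices and switches

-- The delicate half of the switch criterion is that a switch-free matrix has no rival with the same
-- sums: a discrepancy is chased from row to row, and the absence of switches makes the row sums
-- fall along the chase. The staircase is recorded by numeric labels. The sum of the two labels of a
-- cell, compared with `j + 1`, places the cell below, on or above the diagonal; this treats rows
-- and columns alike and is why the formula pairs row block `i` with column block `j + 1 - i`. Marks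
-- on rows and columns determine the 1s, but they can be read back from the matrix only if every
-- marked line has a marked partner; hence the exclusion of blocks with marks on one side only.
-- Matrices thus correspond to codes: a height, two label words and two mark words. Codes are
-- counted by indicator sums over words, in which the mark sums factor over the blocks and the label
-- sums become multinomial coefficients.

∑ : (Fin n → ℕ) → ℕ
∑ f = vsum (tabulate f)

∑-cong : {f g : Fin n → ℕ} → (∀ x → f x ≡ g x) → ∑ f ≡ ∑ g
∑-cong f≗g = cong vsum (Vec.tabulate-cong f≗g)

∑-+ : (f g : Fin n → ℕ) → ∑ (λ x → f x + g x) ≡ ∑ f + ∑ g
∑-+ {zero}  f g = refl
∑-+ {suc n} f g = begin
  f zero + g zero + ∑ (λ x → f (suc x) + g (suc x))      ≡⟨ cong (f zero + g zero +_) (∑-+ (f ∘ suc) (g ∘ suc)) ⟩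
  f zero + g zero + (∑ (f ∘ suc) + ∑ (g ∘ suc))          ≡⟨ lemma (f zero) (g zero) (∑ (f ∘ suc)) (∑ (g ∘ suc)) ⟩
  f zero + ∑ (f ∘ suc) + (g zero + ∑ (g ∘ suc))          ∎
  where
  open ≡-Reasoning
  lemma : ∀ a b c d → a + b + (c + d) ≡ a + c + (b + d)
  lemma = solve-∀

∑-*ˡ : ∀ a (f : Fin n → ℕ) → ∑ (λ x → a * f x) ≡ a * ∑ f
∑-*ˡ {zero}  a f = sym (*-zeroʳ a)
∑-*ˡ {suc n} a f = trans (cong (a * f zero +_) (∑-*ˡ a (f ∘ suc)))
                         (sym (*-distribˡ-+ a (f zero) (∑ (f ∘ suc))))

∑-mono-≤ : {f g : Fin n → ℕ} → (∀ x → f x ≤ g x) → ∑ f ≤ ∑ g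
∑-mono-≤ {zero}  f≤g = z≤n
∑-mono-≤ {suc n} f≤g = +-mono-≤ (f≤g zero) (∑-mono-≤ (f≤g ∘ suc))

∑-mono-< : {f g : Fin n → ℕ} → (∀ x → f x ≤ g x) → ∀ x → f x < g x → ∑ f < ∑ g
∑-mono-< f≤g zero    fx<gx = +-mono-<-≤ fx<gx (∑-mono-≤ (f≤g ∘ suc))
∑-mono-< f≤g (suc x) fx<gx = +-mono-≤-< (f≤g zero) (∑-mono-< (f≤g ∘ suc) x fx<gx)

-- Otherwise `f ≤ g` everywhere with one strict place, and the sums would differ. The descent below
-- uses equal row and column sums only through this.
∑-balance : (f g : Fin n → ℕ) → ∑ f ≡ ∑ g → ∀ x → f x < g x → ∃[ y ] g y < f y
∑-balance f g eq x fx<gx with Fin.any? (λ y → g y <? f y)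
... | yes p  = p
... | no  ¬p = contradiction eq (<⇒≢ (∑-mono-< (λ y → ≮⇒≥ (λ gy<fy → ¬p (y , gy<fy))) x fx<gx))

δ : Fin n → Fin n → ℕ
δ zero    zero    = 1
δ zero    (suc y) = 0
δ (suc x) zero    = 0
δ (suc x) (suc y) = δ x y

δ-refl : (x : Fin n) → δ x x ≡ 1
δ-refl zero    = refl
δ-refl (suc x) = δ-refl x

δ-≢ : {x y : Fin n} → x ≢ y → δ x y ≡ 0
δ-≢ {x = zero}  {zero}  x≢y = contradiction refl x≢y
δ-≢ {x = zero}  {suc y} x≢y = refl
δ-≢ {x = suc x} {zero}  x≢y = refl
δ-≢ {x = suc x} {suc y} x≢y = δ-≢ (x≢y ∘ cong suc)

∑-0 : ∀ n → ∑ {n} (λ _ → 0) ≡ 0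
∑-0 zero    = refl
∑-0 (suc n) = ∑-0 n

∑-δ : (x : Fin n) → ∑ (δ x) ≡ 1
∑-δ {suc n} zero    = cong suc (∑-0 n)
∑-δ {suc n} (suc x) = ∑-δ x

-- Entries and line sums of matrices

entry : TMatrix m n → Fin m → Fin n → ℕ
entry M i c = toℕ (lookup (lookup M i) c)

entry<3 : (M : TMatrix m n) → ∀ i c → entry M i c < 3
entry<3 M i c = Fin.toℕ<n (lookup (lookup M i) c)

fromEntries : (f : Fin m → Fin n → ℕ) → (∀ i c → f i c < 3) → TMatrix m n
fromEntries f f<3 = tabulate (λ i → tabulate (λ c → fromℕ< (f<3 i c)))

entry-fromEntries : (f : Fin m → Fin n → ℕ) (f<3 : ∀ i c → f i c < 3) →
                    ∀ i c → entry (fromEntries f f<3) i c ≡ f i c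
entry-fromEntries f f<3 i c = begin
  toℕ (lookup (lookup (fromEntries f f<3) i) c)        ≡⟨ cong (λ r → toℕ (lookup r c)) (Vec.lookup∘tabulate _ i) ⟩
  toℕ (lookup (tabulate (λ c → fromℕ< (f<3 i c))) c)   ≡⟨ cong toℕ (Vec.lookup∘tabulate _ c) ⟩
  toℕ (fromℕ< (f<3 i c))                               ≡⟨ Fin.toℕ-fromℕ< (f<3 i c) ⟩
  f i c                                                ∎
  where open ≡-Reasoning

lookup-ext : ∀ {A : Set} {xs ys : Vec A n} → (∀ i → lookup xs i ≡ lookup ys i) → xs ≡ ys
lookup-ext {xs = xs} {ys} eq =
  trans (sym (Vec.tabulate∘lookup xs)) (trans (Vec.tabulate-cong eq) (Vec.tabulate∘lookup ys))

entry-ext : (M N : TMatrix m n) → (∀ i c → entry M i c ≡ entry N i c) → M ≡ N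
entry-ext M N eq = lookup-ext λ i → lookup-ext λ c → Fin.toℕ-injective (eq i c)

lookup-columns : ∀ {A : Set} (r : Vec A n) (T : Vec (Vec A m) n) c →
                 lookup ((replicate n Data.Vec._∷_ ⊛ r) ⊛ T) c ≡ lookup r c ∷ lookup T c
lookup-columns (x ∷ r) (t ∷ T) zero    = refl
lookup-columns (x ∷ r) (t ∷ T) (suc c) = lookup-columns r T c

lookup-transpose : ∀ {A : Set} (M : Vec (Vec A n) m) i c →
                   lookup (lookup (transpose M) c) i ≡ lookup (lookup M i) c
lookup-transpose (r ∷ M) i c rewrite lookup-columns r (transpose M) c with i
... | zero   = refl
... | suc i′ = lookup-transpose M i′ c

lookup-rowSums : (M : TMatrix m n) → ∀ i → lookup (rowSums M) i ≡ ∑ (entry M i)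
lookup-rowSums M i = begin
  lookup (rowSums M) i                                  ≡⟨ Vec.lookup-map i _ M ⟩
  vsum (map toℕ (lookup M i))                           ≡⟨ cong (vsum ∘ map toℕ) (Vec.tabulate∘lookup (lookup M i)) ⟨
  vsum (map toℕ (tabulate (lookup (lookup M i))))       ≡⟨ cong vsum (Vec.tabulate-∘ toℕ (lookup (lookup M i))) ⟨
  ∑ (entry M i)                                         ∎
  where open ≡-Reasoning

lookup-colSums : (M : TMatrix m n) → ∀ c → lookup (colSums M) c ≡ ∑ (λ i → entry M i c)
lookup-colSums M c = trans (lookup-rowSums (transpose M) c)
                           (∑-cong (λ i → cong toℕ (lookup-transpose M i c)))

-- Switches and uniqueness

NoSwitch : (Fin m → Fin n → ℕ) → Set
NoSwitch f = ∀ {i i′ c c′} → i ≢ i′ → c ≢ c′ →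
             0 < f i c → 0 < f i′ c′ → f i c′ < 2 → f i′ c < 2 → ⊥

module Switch (M : TMatrix m n) {i i′ : Fin m} {c c′ : Fin n} (i≢i′ : i ≢ i′) (c≢c′ : c ≢ c′)
  (ic>0 : 0 < entry M i c) (i′c′>0 : 0 < entry M i′ c′)
  (ic′<2 : entry M i c′ < 2) (i′c<2 : entry M i′ c < 2) where

  -- A unit moves from the corners `(i , c)` and `(i′ , c′)` to the other two. Gain and loss are
  -- kept apart so that line sums can be compared without subtraction.
  inc dec : Fin m → Fin n → ℕ
  inc r x = δ i r * δ c′ x + δ i′ r * δ c x
  dec r x = δ i r * δ c x + δ i′ r * δ c′ x

  -- The first bound makes the truncated subtraction in `switched` exact, the second keeps the new
  -- entries below 3. The four conditions of a switch enter at one corner each.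
  bounds : ∀ r x → dec r x ≤ entry M r x + inc r x × entry M r x + inc r x < 3 + dec r x
  bounds r x with i Fin.≟ r | i′ Fin.≟ r | c Fin.≟ x | c′ Fin.≟ x
  ... | yes refl | yes refl | _ | _ = contradiction refl i≢i′
  ... | _ | _ | yes refl | yes refl = contradiction refl c≢c′
  ... | no p | no q | _ | _ rewrite δ-≢ p | δ-≢ q | +-identityʳ (entry M r x) = z≤n , entry<3 M r x
  ... | yes refl | no q | yes refl | no s
    rewrite δ-refl i | δ-≢ q | δ-refl c | δ-≢ s | +-identityʳ (entry M i c) = ic>0 , m≤n⇒m≤1+n (entry<3 M i c)
  ... | yes refl | no q | no s | yes refl
    rewrite δ-refl i | δ-≢ q | δ-refl c′ | δ-≢ s | +-comm (entry M i c′) 1 = z≤n , s≤s ic′<2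
  ... | yes refl | no q | no s | no t
    rewrite δ-refl i | δ-≢ q | δ-≢ t | δ-≢ s | +-identityʳ (entry M i x) = z≤n , entry<3 M i x
  ... | no q | yes refl | yes refl | no s
    rewrite δ-refl i′ | δ-≢ q | δ-refl c | δ-≢ s | +-comm (entry M i′ c) 1 = z≤n , s≤s i′c<2
  ... | no q | yes refl | no s | yes refl
    rewrite δ-refl i′ | δ-≢ q | δ-refl c′ | δ-≢ s | +-identityʳ (entry M i′ c′) = i′c′>0 , m≤n⇒m≤1+n (entry<3 M i′ c′)
  ... | no q | yes refl | no s | no t
    rewrite δ-refl i′ | δ-≢ q | δ-≢ t | δ-≢ s | +-identityʳ (entry M i′ x) = z≤n , entry<3 M i′ x

  switched<3 : ∀ r x → entry M r x + inc r x ∸ dec r x < 3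
  switched<3 r x = +-cancelʳ-< (dec r x) _ _ (subst (_< 3 + dec r x) (sym (m∸n+n≡m (proj₁ (bounds r x)))) (proj₂ (bounds r x)))

  switched : TMatrix m n
  switched = fromEntries (λ r x → entry M r x + inc r x ∸ dec r x) switched<3

  entry-switched : ∀ r x → entry switched r x + dec r x ≡ entry M r x + inc r x
  entry-switched r x = trans (cong (_+ dec r x) (entry-fromEntries _ switched<3 r x)) (m∸n+n≡m (proj₁ (bounds r x)))

  ∑-row : ∀ {k} (f g : Fin k → ℕ) → ∑ f ≡ 1 → ∑ g ≡ 1 → ∀ a b → ∑ (λ x → a * f x + b * g x) ≡ a + b
  ∑-row f g f≡1 g≡1 a b = begin
    ∑ (λ x → a * f x + b * g x)                ≡⟨ ∑-+ (λ x → a * f x) (λ x → b * g x) ⟩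
    ∑ (λ x → a * f x) + ∑ (λ x → b * g x)      ≡⟨ cong₂ _+_ (∑-*ˡ a f) (∑-*ˡ b g) ⟩
    a * ∑ f + b * ∑ g                          ≡⟨ cong₂ (λ u v → a * u + b * v) f≡1 g≡1 ⟩
    a * 1 + b * 1                              ≡⟨ cong₂ _+_ (*-identityʳ a) (*-identityʳ b) ⟩
    a + b                                      ∎
    where open ≡-Reasoning

  balanced : ∀ {k} (f g p q : Fin k → ℕ) → (∀ x → f x + p x ≡ g x + q x) → ∑ p ≡ ∑ q → ∑ f ≡ ∑ g
  balanced f g p q eq p≡q = +-cancelʳ-≡ (∑ p) (∑ f) (∑ g) (begin
    ∑ f + ∑ p               ≡⟨ ∑-+ f p ⟨
    ∑ (λ x → f x + p x)     ≡⟨ ∑-cong eq ⟩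
    ∑ (λ x → g x + q x)     ≡⟨ ∑-+ g q ⟩
    ∑ g + ∑ q               ≡⟨ cong (∑ g +_) p≡q ⟨
    ∑ g + ∑ p               ∎)
    where open ≡-Reasoning

  sameRowSums : rowSums switched ≡ rowSums M
  sameRowSums = lookup-ext λ r → begin
    lookup (rowSums switched) r    ≡⟨ lookup-rowSums switched r ⟩
    ∑ (entry switched r)           ≡⟨ balanced _ _ (dec r) (inc r) (entry-switched r)
                                        (trans (∑-row (δ c) (δ c′) (∑-δ c) (∑-δ c′) (δ i r) (δ i′ r))
                                          (sym (∑-row (δ c′) (δ c) (∑-δ c′) (∑-δ c) (δ i r) (δ i′ r)))) ⟩
    ∑ (entry M r)                  ≡⟨ lookup-rowSums M r ⟨
    lookup (rowSums M) r           ∎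
    where open ≡-Reasoning

  sameColSums : colSums switched ≡ colSums M
  sameColSums = lookup-ext λ x → begin
    lookup (colSums switched) x       ≡⟨ lookup-colSums switched x ⟩
    ∑ (λ r → entry switched r x)      ≡⟨ balanced _ _ (λ r → dec r x) (λ r → inc r x) (λ r → entry-switched r x)
                                           (trans (∑-column (δ c x) (δ c′ x))
                                             (trans (+-comm (δ c x) (δ c′ x)) (sym (∑-column (δ c′ x) (δ c x))))) ⟩
    ∑ (λ r → entry M r x)             ≡⟨ lookup-colSums M x ⟨
    lookup (colSums M) x              ∎
    where
    open ≡-Reasoning
    ∑-column : ∀ a b → ∑ (λ r → δ i r * a + δ i′ r * b) ≡ a + b
    ∑-column a b = trans (∑-cong (λ r → cong₂ _+_ (*-comm (δ i r) a) (*-comm (δ i′ r) b)))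
                           (∑-row (δ i) (δ i′) (∑-δ i) (∑-δ i′) a b)

  switched≢ : switched ≢ M
  switched≢ eq = contradiction (trans (sym dec≡1) (trans dec≡inc inc≡0)) λ ()
    where
    dec≡inc : dec i c ≡ inc i c
    dec≡inc = +-cancelˡ-≡ (entry M i c) (dec i c) (inc i c)
                (subst (λ N → entry N i c + dec i c ≡ entry M i c + inc i c) eq (entry-switched i c))
    dec≡1 : dec i c ≡ 1
    dec≡1 rewrite δ-refl i | δ-refl c | δ-≢ (i≢i′ ∘ sym) = refl
    inc≡0 : inc i c ≡ 0
    inc≡0 rewrite δ-refl i | δ-≢ (c≢c′ ∘ sym) | δ-≢ (i≢i′ ∘ sym) = refl

lonesum⇒noSwitch : (M : TMatrix m n) → IsLonesum M → NoSwitch (entry M)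
lonesum⇒noSwitch M lonesum i≢i′ c≢c′ p q r s = switched≢ (lonesum switched sameRowSums sameColSums)
  where open Switch M i≢i′ c≢c′ p q r s

-- A cell where N is smaller than M leads, through a cell of the same column where N is larger, to
-- another row of M with a cell where N is smaller.  By the absence of switches this row is
-- entrywise at most the previous one, and two such steps make the row sum strictly smaller.
module Descent (f g : Fin m → Fin n → ℕ) (f<3 : ∀ i c → f i c < 3) (g<3 : ∀ i c → g i c < 3)
  (rows : ∀ i → ∑ (g i) ≡ ∑ (f i)) (cols : ∀ c → ∑ (λ i → g i c) ≡ ∑ (λ i → f i c))
  (noSwitch : NoSwitch f) where

  record Step (i : Fin m) (c : Fin n) : Set where
    field
      i′     : Fin m
      c′     : Fin n
      i≢i′   : i ≢ i′
      up     : f i′ c < g i′ c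
      down   : g i′ c′ < f i′ c′

    c≢c′ : c ≢ c′
    c≢c′ c≡c′ = <-asym down (subst (λ x → f i′ x < g i′ x) c≡c′ up)

    i′c<2 : f i′ c < 2
    i′c<2 = <-≤-trans up (s≤s⁻¹ (g<3 i′ c))

    -- A column where row `i′` is positive and row `i` below 2 would form a switch with column `c`,
    -- because `f i′ c` is exceeded by an entry of `g` and so is below 2.
    dominated : 0 < f i c → ∀ x → x ≢ c → f i′ x ≤ f i x
    dominated ic>0 x x≢c with 0 <? f i′ x | f i x <? 2
    ... | no  ≯0 | _      = ≤-trans (≮⇒≥ ≯0) z≤n
    ... | yes >0 | yes <2 = ⊥-elim (noSwitch i≢i′ (x≢c ∘ sym) ic>0 >0 <2 i′c<2)
    ... | yes >0 | no  ≮2 = ≤-trans (s≤s⁻¹ (f<3 i′ x)) (≮⇒≥ ≮2)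

    dominated′ : 0 < f i c → ∀ x → f i′ x ≤ f i x
    dominated′ ic>0 x with x Fin.≟ c
    ... | yes refl = ≤-trans (s≤s⁻¹ i′c<2) ic>0
    ... | no  x≢c  = dominated ic>0 x x≢c

    saturated : 0 < f i c → 2 ≤ f i c′
    saturated ic>0 = ≮⇒≥ λ <2 → noSwitch i≢i′ c≢c′ ic>0 (≤-<-trans z≤n down) <2 i′c<2

  step : ∀ i c → g i c < f i c → Step i c
  step i c down with ∑-balance (λ i → g i c) (λ i → f i c) (cols c) i down
  ... | i′ , up with ∑-balance (f i′) (g i′) (sym (rows i′)) c up
  ... | c′ , down′ = record { i′ = i′ ; c′ = c′ ; i≢i′ = λ { refl → <-asym up down } ; up = up ; down = down′ }

  descend : ∀ i c → g i c < f i c → Acc _<_ (∑ (f i)) → ⊥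
  descend i c down (acc rec) with step i c down
  ... | s with ∑ (f (Step.i′ s)) <? ∑ (f i)
  ... | yes smaller = descend (Step.i′ s) (Step.c′ s) (Step.down s) (rec smaller)
  -- The sum did not drop, so the saturated entry `f i c′` forces the entry below it in the new row
  -- to be 2 as well. The second step reaches a row whose entry in that column is below 2, which
  -- makes the sum drop.
  ... | no ≮ with step (Step.i′ s) (Step.c′ s) (Step.down s)
  ... | t = descend (Step.i′ t) (Step.c′ t) (Step.down t) (rec (<-≤-trans second (∑-mono-≤ first)))
    where
    ic>0 : 0 < f i c
    ic>0 = ≤-<-trans z≤n down
    i′c′>0 : 0 < f (Step.i′ s) (Step.c′ s)
    i′c′>0 = ≤-<-trans z≤n (Step.down s)
    first : ∀ x → f (Step.i′ s) x ≤ f i x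
    first = Step.dominated′ s ic>0
    i′c′≡2 : 2 ≤ f (Step.i′ s) (Step.c′ s)
    i′c′≡2 with f (Step.i′ s) (Step.c′ s) <? 2
    ... | no  ≮2 = ≮⇒≥ ≮2
    ... | yes <2 = contradiction (∑-mono-< first (Step.c′ s) (<-≤-trans <2 (Step.saturated s ic>0))) ≮
    second : ∑ (f (Step.i′ t)) < ∑ (f (Step.i′ s))
    second = ∑-mono-< (Step.dominated′ t i′c′>0) (Step.c′ s) (<-≤-trans (Step.i′c<2 t) i′c′≡2)

  agree : ∀ i c → g i c ≡ f i c
  agree i c with <-cmp (g i c) (f i c)
  ... | tri< down _ _ = ⊥-elim (descend i c down (<-wellFounded _))
  ... | tri≈ _ eq _   = eq
  -- An excess of `g` is compensated by a deficit in the same row, and deficits are already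
  -- excluded.
  ... | tri> _ _ up with ∑-balance (f i) (g i) (sym (rows i)) c up
  ... | c′ , down = ⊥-elim (descend i c′ down (<-wellFounded _))

noSwitch⇒lonesum : (M : TMatrix m n) → NoSwitch (entry M) → IsLonesum M
noSwitch⇒lonesum M noSwitch N rows cols = entry-ext N M agree
  where
  open Descent (entry M) (entry N) (entry<3 M) (entry<3 N)
    (λ i → trans (sym (lookup-rowSums N i)) (trans (cong (λ v → lookup v i) rows) (lookup-rowSums M i)))
    (λ c → trans (sym (lookup-colSums N c)) (trans (cong (λ v → lookup v c) cols) (lookup-colSums M c)))
    noSwitch

-- Block structure of switch-free matrices

-- Rows and columns are cut into blocks labelled 0, …, j, of which only block 0 may be empty, and
-- the marked rows and columns are those containing an entry 1.  The entry is 0 where the two labels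
-- sum to at most j and 2 where they sum to more than j + 1; on the diagonal blocks it is 1 if row
-- and column are both marked, and 2 otherwise.
record Layout (j : ℕ) (X : Fin m → ℕ) (Y : Fin n → ℕ) (μ : Fin m → Bool) (ν : Fin n → Bool) : Set where
  field
    X≤j      : ∀ i → X i ≤ j
    Y≤j      : ∀ c → Y c ≤ j
    X-onto   : ∀ t → t < j → ∃[ i ] X i ≡ suc t
    Y-onto   : ∀ t → t < j → ∃[ c ] Y c ≡ suc t
    partnerˣ : ∀ i → T (μ i) → ∃[ c ] T (ν c) × X i + Y c ≡ suc j
    partnerʸ : ∀ c → T (ν c) → ∃[ i ] T (μ i) × X i + Y c ≡ suc j
    thin     : ∀ {i i′ c c′} → i ≢ i′ → c ≢ c′ → T (μ i) → T (μ i′) → T (ν c) → T (ν c′) →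
               X i + Y c ≡ suc j → X i′ + Y c ≡ suc j → X i + Y c′ ≡ suc j → ⊥

record Depicts (j : ℕ) (X : Fin m → ℕ) (Y : Fin n → ℕ) (μ : Fin m → Bool) (ν : Fin n → Bool)
               (f : Fin m → Fin n → ℕ) : Set where
  field
    positive  : ∀ {i c} → 0 < f i c → j < X i + Y c
    positive⁻ : ∀ {i c} → j < X i + Y c → 0 < f i c
    one       : ∀ {i c} → f i c ≡ 1 → X i + Y c ≡ suc j × T (μ i) × T (ν c)
    one⁻      : ∀ {i c} → X i + Y c ≡ suc j → T (μ i) → T (ν c) → f i c ≡ 1

flipLayout : ∀ {j} {X : Fin m → ℕ} {Y : Fin n → ℕ} {μ ν} → Layout j X Y μ ν → Layout j Y X ν μ
flipLayout {j = j} {X} {Y} L = record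
  { X≤j = Y≤j ; Y≤j = X≤j ; X-onto = Y-onto ; Y-onto = X-onto
  ; partnerˣ = λ c νc → let i , μi , eq = partnerʸ c νc in i , μi , comm c i eq
  ; partnerʸ = λ i μi → let c , νc , eq = partnerˣ i μi in c , νc , comm c i eq
  ; thin = λ {c} {c′} {i} {i′} c≢c′ i≢i′ νc νc′ μi μi′ p q r →
      thin i≢i′ c≢c′ μi μi′ νc νc′ (comm′ c i p) (comm′ c i′ r) (comm′ c′ i q)
  }
  where
  open Layout L
  comm : ∀ c i → X i + Y c ≡ suc j → Y c + X i ≡ suc j
  comm c i = trans (+-comm (Y c) (X i))
  comm′ : ∀ c i → Y c + X i ≡ suc j → X i + Y c ≡ suc j
  comm′ c i = trans (+-comm (X i) (Y c))

flipDepicts : ∀ {j} {X : Fin m → ℕ} {Y : Fin n → ℕ} {μ ν f} → Depicts j X Y μ ν f → Depicts j Y X ν μ (flip f)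
flipDepicts {j = j} {X} {Y} D = record
  { positive  = λ {c} {i} p → subst (j <_) (+-comm (X i) (Y c)) (positive p)
  ; positive⁻ = λ {c} {i} p → positive⁻ (subst (j <_) (+-comm (Y c) (X i)) p)
  ; one       = λ {c} {i} p → let eq , μi , νc = one p in trans (+-comm (Y c) (X i)) eq , νc , μi
  ; one⁻      = λ {c} {i} eq νc μi → one⁻ (trans (+-comm (X i) (Y c)) eq) μi νc
  }
  where open Depicts D

-- Two terms at least `k` balance two terms at most `k`, which leaves no slack in any of them.
squeeze : ∀ k {a b d e} → a + d ≡ b + e → k ≤ a → k ≤ d → b ≤ k → e ≤ k → a ≡ k × b ≡ k × e ≡ k
squeeze k {a} {b} {d} {e} eq k≤a k≤d b≤k e≤k =
    ≤-antisym (+-cancelʳ-≤ k a k (begin a + k ≤⟨ +-monoʳ-≤ a k≤d ⟩ a + d ≡⟨ eq ⟩ b + e ≤⟨ +-mono-≤ b≤k e≤k ⟩ k + k ∎)) k≤a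
  , ≤-antisym b≤k (+-cancelʳ-≤ k k b (begin k + k ≤⟨ +-mono-≤ k≤a k≤d ⟩ a + d ≡⟨ eq ⟩ b + e ≤⟨ +-monoʳ-≤ b e≤k ⟩ b + k ∎))
  , ≤-antisym e≤k (+-cancelˡ-≤ k k e (begin k + k ≤⟨ +-mono-≤ k≤a k≤d ⟩ a + d ≡⟨ eq ⟩ b + e ≤⟨ +-monoˡ-≤ e b≤k ⟩ k + e ∎))
  where open ≤-Reasoning

module _ {j : ℕ} {X : Fin m → ℕ} {Y : Fin n → ℕ} {μ : Fin m → Bool} {ν : Fin n → Bool} {f : Fin m → Fin n → ℕ}
         (L : Layout j X Y μ ν) (D : Depicts j X Y μ ν f) where
  open Layout L
  open Depicts D

  private
    <2⇒≤ : ∀ {i c} → f i c < 2 → X i + Y c ≤ suc j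
    <2⇒≤ {i} {c} <2 with j <? X i + Y c
    ... | no  ≮ = m≤n⇒m≤1+n (≮⇒≥ ≮)
    ... | yes p = ≤-reflexive (proj₁ (one (≤-antisym (s≤s⁻¹ <2) (positive⁻ p))))

    <2⇒≡1 : ∀ {i c} → f i c < 2 → X i + Y c ≡ suc j → f i c ≡ 1
    <2⇒≡1 <2 eq = ≤-antisym (s≤s⁻¹ <2) (positive⁻ (≤-reflexive (sym eq)))

  -- Opposite corners of a rectangle have the same total of labels, so `squeeze` pushes the corners
  -- of a switch onto the diagonal. The two corners below 2 are then 1s, hence both rows and both
  -- columns are marked, against `thin`.
  layout⇒noSwitch : NoSwitch f
  layout⇒noSwitch {i} {i′} {c} {c′} i≢i′ c≢c′ p q r s
    with squeeze (suc j) (exchange (X i) (Y c) (X i′) (Y c′)) (positive p) (positive q) (<2⇒≤ r) (<2⇒≤ s)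
    where
    exchange : ∀ x y x′ y′ → x + y + (x′ + y′) ≡ x + y′ + (x′ + y)
    exchange = solve-∀
  ... | ic , ic′ , i′c with one (<2⇒≡1 r ic′) | one (<2⇒≡1 s i′c)
  ... | _ , μi , νc′ | _ , μi′ , νc = thin i≢i′ c≢c′ μi μi′ νc νc′ ic i′c ic′

-- Uniqueness of the layout of a matrix

module _ {j₁ j₂ : ℕ} {X₁ X₂ : Fin m → ℕ} {Y₁ Y₂ : Fin n → ℕ}
         {μ₁ μ₂ : Fin m → Bool} {ν₁ ν₂ : Fin n → Bool} {f : Fin m → Fin n → ℕ}
         (L₁ : Layout j₁ X₁ Y₁ μ₁ ν₁) (D₁ : Depicts j₁ X₁ Y₁ μ₁ ν₁ f)
         (L₂ : Layout j₂ X₂ Y₂ μ₂ ν₂) (D₂ : Depicts j₂ X₂ Y₂ μ₂ ν₂ f) where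
  private
    module L₁ = Layout L₁
    module L₂ = Layout L₂
    module D₁ = Depicts D₁
    module D₂ = Depicts D₂

  -- The column is taken from the block diagonal to that of row `i` in the first layout: it is
  -- positive in row `i` and zero in the rows labelled `s`. Both facts concern `f` alone and so pass
  -- to the second layout.
  boundaryColumn : ∀ s i → X₁ i ≡ suc s → ∃[ c ] s + Y₁ c ≡ j₁ × j₂ < X₂ i + Y₂ c
  boundaryColumn s i eq with L₁.Y-onto (j₁ ∸ suc s) (∸-monoʳ-< {o = 0} z<s s<j)
    where
    s<j : s < j₁
    s<j = subst (_≤ j₁) eq (L₁.X≤j i)
  ... | c , Yc = c , s+Yc , D₂.positive (D₁.positive⁻ (≤-reflexive (sym (trans (cong (_+ Y₁ c) eq) (cong suc s+Yc)))))
    where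
    s+Yc : s + Y₁ c ≡ j₁
    s+Yc = trans (cong (s +_) Yc) (trans (+-suc s (j₁ ∸ suc s)) (m+[n∸m]≡n (subst (_≤ j₁) eq (L₁.X≤j i))))

  -- A boundary column of row `i` is absent from a row one label lower. In the second layout that
  -- lower row must therefore have a strictly smaller label, so the second labels rise at least as
  -- fast as the first.
  label-≤ : ∀ t i → X₁ i ≡ t → t ≤ X₂ i
  label-≤ zero          i eq = z≤n
  label-≤ (suc zero)    i eq with boundaryColumn 0 i eq
  ... | c , _ , contains = +-cancelʳ-≤ j₂ 1 (X₂ i) (≤-trans contains (+-monoʳ-≤ (X₂ i) (L₂.Y≤j c)))
  label-≤ (suc (suc r)) i eq =
    let c , sum≡ , contains = boundaryColumn (suc r) i eq
        i₂ , i₂≡ = L₁.X-onto r (<-trans (n<1+n r) (subst (_≤ j₁) eq (L₁.X≤j i)))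
        avoids = ≮⇒≥ λ p → <-irrefl refl
          (subst (j₁ <_) (trans (cong (_+ Y₁ c) i₂≡) sum≡) (D₁.positive (D₂.positive⁻ {i₂} {c} p)))
    in ≤-<-trans (label-≤ (suc r) i₂ i₂≡) (+-cancelʳ-< (Y₂ c) (X₂ i₂) (X₂ i) (≤-<-trans avoids contains))

  height-≤ : (∀ i → X₁ i ≡ X₂ i) → j₁ ≤ j₂
  height-≤ X≡ = go j₁ refl
    where
    go : ∀ k → k ≡ j₁ → k ≤ j₂
    go zero    _    = z≤n
    go (suc k) k≡j₁ = let i , eq = L₁.X-onto k (≤-reflexive k≡j₁) in
                      subst (_≤ j₂) (trans (sym (X≡ i)) eq) (L₂.X≤j i)

  -- The partner of a marked row exhibits a 1 in it, and a 1 of `f` carries marks in every layout.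
  mark-mono : ∀ i → T (μ₁ i) → T (μ₂ i)
  mark-mono i μi = let c , νc , eq = L₁.partnerˣ i μi in proj₁ (proj₂ (D₂.one (D₁.one⁻ eq μi νc)))

T-ext : ∀ {a b} → (T a → T b) → (T b → T a) → a ≡ b
T-ext {false} {false} f g = refl
T-ext {false} {true}  f g = ⊥-elim (g tt)
T-ext {true}  {false} f g = ⊥-elim (f tt)
T-ext {true}  {true}  f g = refl

module _ {j₁ j₂ : ℕ} {X₁ X₂ : Fin m → ℕ} {Y₁ Y₂ : Fin n → ℕ}
         {μ₁ μ₂ : Fin m → Bool} {ν₁ ν₂ : Fin n → Bool} {f : Fin m → Fin n → ℕ}
         (L₁ : Layout j₁ X₁ Y₁ μ₁ ν₁) (D₁ : Depicts j₁ X₁ Y₁ μ₁ ν₁ f)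
         (L₂ : Layout j₂ X₂ Y₂ μ₂ ν₂) (D₂ : Depicts j₂ X₂ Y₂ μ₂ ν₂ f) where

  rowLabels-unique : ∀ i → X₁ i ≡ X₂ i
  rowLabels-unique i = ≤-antisym (label-≤ L₁ D₁ L₂ D₂ _ i refl) (label-≤ L₂ D₂ L₁ D₁ _ i refl)

  height-unique : j₁ ≡ j₂
  height-unique = ≤-antisym (height-≤ L₁ D₁ L₂ D₂ rowLabels-unique)
                            (height-≤ L₂ D₂ L₁ D₁ (sym ∘ rowLabels-unique))

  rowMarks-unique : ∀ i → μ₁ i ≡ μ₂ i
  rowMarks-unique i = T-ext (mark-mono L₁ D₁ L₂ D₂ i) (mark-mono L₂ D₂ L₁ D₁ i)

-- Construction of a layout from the row supports

sgn : ℕ → ℕ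
sgn zero    = 0
sgn (suc _) = 1

sgn-pos : ∀ {a} → 0 < a → sgn a ≡ 1
sgn-pos {suc a} _ = refl

sgn-mono : ∀ {a b} → (0 < a → 0 < b) → sgn a ≤ sgn b
sgn-mono {zero}  {b}     f = z≤n
sgn-mono {suc a} {suc b} f = ≤-refl
sgn-mono {suc a} {zero}  f = contradiction (f z<s) λ ()

sgn-< : ∀ {a b} → sgn a < sgn b → 0 < b × a ≡ 0
sgn-< {zero}  {suc b} _ = z<s , refl
sgn-< {suc a} {suc b} p = contradiction p (<-irrefl refl)

∑-sgn≤ : (f : Fin n → ℕ) → ∑ (sgn ∘ f) ≤ n
∑-sgn≤ {zero}  f = z≤n
∑-sgn≤ {suc n} f with f zero
... | zero  = m≤n⇒m≤1+n (∑-sgn≤ (f ∘ suc))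
... | suc _ = s≤s (∑-sgn≤ (f ∘ suc))

⨆ : (Fin n → ℕ) → ℕ
⨆ {zero}  f = 0
⨆ {suc n} f = f zero ⊔ ⨆ (f ∘ suc)

≤⨆ : (f : Fin n → ℕ) → ∀ x → f x ≤ ⨆ f
≤⨆ f zero    = m≤m⊔n (f zero) _
≤⨆ f (suc x) = ≤-trans (≤⨆ (f ∘ suc) x) (m≤n⊔m (f zero) _)

⨆-attained : (f : Fin n → ℕ) → 0 < ⨆ f → ∃[ x ] f x ≡ ⨆ f
⨆-attained {suc n} f >0 with ⊔-sel (f zero) (⨆ (f ∘ suc))
... | inj₁ eq = zero , sym eq
... | inj₂ eq with ⨆-attained (f ∘ suc) (subst (0 <_) eq >0)
... | x , fx = suc x , trans fx (sym eq)

module Rank (φ : Fin m → ℕ) where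

  isValue? : ∀ k → Dec (∃[ i ] φ i ≡ k)
  isValue? k = Fin.any? (λ i → φ i ≟ k)

  -- The number of distinct values of `φ` among 1, ..., k. It compresses the values to consecutive
  -- labels and keeps label 0 for the value 0.
  rank : ℕ → ℕ
  rank zero    = 0
  rank (suc k) with isValue? (suc k)
  ... | yes _ = suc (rank k)
  ... | no  _ = rank k

  rank-suc : ∀ {k} i → φ i ≡ suc k → rank (suc k) ≡ suc (rank k)
  rank-suc {k} i eq with isValue? (suc k)
  ... | yes _ = refl
  ... | no ¬p = contradiction (i , eq) ¬p

  rank-step : ∀ k → rank k ≤ rank (suc k)
  rank-step k with isValue? (suc k)
  ... | yes _ = n≤1+n _
  ... | no  _ = ≤-refl

  rank-mono : ∀ {k l} → k ≤ l → rank k ≤ rank l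
  rank-mono {k} {zero}  z≤n = ≤-refl
  rank-mono {k} {suc l} k≤1+l with m≤n⇒m<n∨m≡n k≤1+l
  ... | inj₁ k<1+l = ≤-trans (rank-mono (s≤s⁻¹ k<1+l)) (rank-step l)
  ... | inj₂ refl  = ≤-refl

  rank-mono-< : ∀ {k} i → k < φ i → rank k < rank (φ i)
  rank-mono-< i k<φ with φ i in eq
  ... | suc l = subst (_ <_) (sym (rank-suc i eq)) (s≤s (rank-mono (s≤s⁻¹ k<φ)))

  rank-onto : ∀ N t → t < rank N → ∃[ i ] rank (φ i) ≡ suc t
  rank-onto (suc N) t t< with isValue? (suc N)
  ... | no  _ = rank-onto N t t<
  ... | yes (i , eq) with m≤n⇒m<n∨m≡n (s≤s⁻¹ t<)
  ... | inj₁ t<N = rank-onto N t t<N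
  ... | inj₂ t≡  = i , trans (cong rank eq) (trans (rank-suc i eq) (cong suc (sym t≡)))

module Analysis (f : Fin m → Fin n → ℕ) (f<3 : ∀ i c → f i c < 3) (noSwitch : NoSwitch f) where

  φ : Fin m → ℕ
  φ i = ∑ (sgn ∘ f i)

  open Rank φ

  -- If a column of row `i` were missing from row `i′`, then every column of row `i′` would belong
  -- to row `i`, as otherwise two zeros complete a switch. Row `i` would have strictly larger
  -- support.
  φ-chain : ∀ {i i′ c} → φ i ≤ φ i′ → 0 < f i c → 0 < f i′ c
  φ-chain {i} {i′} {c} φ≤ ic>0 with 0 <? f i′ c
  ... | yes p = p
  ... | no ¬p = contradiction φ≤ (<⇒≱ (∑-mono-< (λ x → sgn-mono (converse x)) c
                  (subst₂ _<_ (sym (cong sgn i′c≡0)) (sym (sgn-pos ic>0)) z<s)))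
    where
    i′c≡0 : f i′ c ≡ 0
    i′c≡0 = n≤0⇒n≡0 (≮⇒≥ ¬p)
    converse : ∀ x → 0 < f i′ x → 0 < f i x
    converse x i′x>0 with 0 <? f i x
    ... | yes q = q
    ... | no ¬q = ⊥-elim (noSwitch (λ { refl → ¬p ic>0 }) (λ { refl → ¬p i′x>0 }) ic>0 i′x>0
                    (≤-<-trans (≮⇒≥ ¬q) z<s) (≤-<-trans (≮⇒≥ ¬p) z<s))

  φ-witness : ∀ {i i′} → φ i < φ i′ → ∃[ c ] 0 < f i′ c × f i c ≡ 0
  φ-witness {i} {i′} φ< with Fin.any? (λ c → sgn (f i c) <? sgn (f i′ c))
  ... | yes (c , lt) = c , sgn-< lt
  ... | no ¬p = contradiction φ< (≤⇒≯ (∑-mono-≤ (λ c → ≮⇒≥ (λ lt → ¬p (c , lt)))))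

  height : ℕ
  height = rank n

  X : Fin m → ℕ
  X i = rank (φ i)

  X≤j : ∀ i → X i ≤ height
  X≤j i = rank-mono (∑-sgn≤ (f i))

  X-onto : ∀ t → t < height → ∃[ i ] X i ≡ suc t
  X-onto = rank-onto n

  X-chain : ∀ {i i′ c} → X i ≤ X i′ → 0 < f i c → 0 < f i′ c
  X-chain {i} X≤ = φ-chain (≮⇒≥ (λ φ> → <⇒≱ (rank-mono-< i φ>) X≤))

  X-witness : ∀ {i i′} → X i < X i′ → ∃[ c ] 0 < f i′ c × f i c ≡ 0
  X-witness X< = φ-witness (≰⇒> (λ φ≥ → <⇒≱ X< (rank-mono φ≥)))

  X-pos : ∀ {i c} → 0 < f i c → 0 < X i
  X-pos {i} {c} ic>0 = rank-mono-< i (subst (_< φ i) (∑-0 n)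
    (∑-mono-< {f = λ _ → 0} (λ _ → z≤n) c (subst (0 <_) (sym (sgn-pos ic>0)) z<s)))

  X-inhabited : ∀ {i} → 0 < X i → ∃[ c ] 0 < f i c
  X-inhabited {i} X>0 with Fin.any? (λ c → 0 <? f i c)
  ... | yes p = p
  ... | no ¬p = contradiction (<-≤-trans X>0 (rank-mono φ≤0)) (<-irrefl refl)
    where
    φ≤0 : φ i ≤ 0
    φ≤0 = ≤-trans (∑-mono-≤ {g = λ _ → 0} (λ c → sgn-mono {b = 0} (λ p → contradiction (c , p) ¬p))) (≤-reflexive (∑-0 n))

  -- A column is positive exactly in the rows from some label on. The maximum of `depth` is
  -- `height + 1` minus that least label, and the factor `sgn` gives label 0 to an empty column.
  depth : Fin n → Fin m → ℕ
  depth c i = sgn (f i c) * (suc height ∸ X i)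

  depth≡ : ∀ {c i} → 0 < f i c → depth c i ≡ suc height ∸ X i
  depth≡ p = trans (cong (_* _) (sgn-pos p)) (*-identityˡ _)

  Y : Fin n → ℕ
  Y c = ⨆ (depth c)

  Y-attained : ∀ {c} → 0 < Y c → ∃[ i ] 0 < f i c × Y c ≡ suc height ∸ X i
  Y-attained {c} Y>0 with ⨆-attained (depth c) Y>0
  ... | i , eq = i , ic>0 , trans (sym eq) (depth≡ ic>0)
    where
    ic>0 : 0 < f i c
    ic>0 with f i c | subst (0 <_) (sym eq) Y>0
    ... | suc _ | _ = z<s

  ≤Y : ∀ {i c} → 0 < f i c → suc height ∸ X i ≤ Y c
  ≤Y {i} {c} ic>0 = subst (_≤ Y c) (depth≡ ic>0) (≤⨆ (depth c) i)

  positive : ∀ {i c} → 0 < f i c → height < X i + Y c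
  positive {i} ic>0 = ≤-trans (m≤n+m∸n (suc height) (X i)) (+-monoʳ-≤ (X i) (≤Y ic>0))

  Y>0 : ∀ {i c} → height < X i + Y c → 0 < Y c
  Y>0 {i} {c} height< = +-cancelˡ-< height 0 (Y c) (subst (_< height + Y c) (sym (+-identityʳ height)) (<-≤-trans height< (+-monoˡ-≤ (Y c) (X≤j i))))

  lowest : ∀ {i c} → height < X i + Y c → ∃[ i₀ ] 0 < f i₀ c × X i₀ + Y c ≡ suc height
  lowest {i} {c} height< with Y-attained (Y>0 {i} height<)
  ... | i₀ , i₀c>0 , eq = i₀ , i₀c>0 , trans (cong (X i₀ +_) eq) (m+[n∸m]≡n (m≤n⇒m≤1+n (X≤j i₀)))

  positive⁻ : ∀ {i c} → height < X i + Y c → 0 < f i c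
  positive⁻ {i} {c} height< with lowest {i} height<
  ... | i₀ , i₀c>0 , eq = X-chain (+-cancelʳ-≤ (Y c) (X i₀) (X i) (subst (_≤ X i + Y c) (sym eq) height<)) i₀c>0

  Y≤j : ∀ c → Y c ≤ height
  Y≤j c with 0 <? Y c
  ... | no  ≯0 = ≤-trans (≮⇒≥ ≯0) z≤n
  ... | yes >0 with Y-attained >0
  ... | i , ic>0 , eq = subst (_≤ height) (sym eq) (∸-monoʳ-≤ (suc height) (X-pos ic>0))

  -- Supports grow strictly from block to block, so each nonzero block brings in a column absent
  -- from all earlier ones. Such columns realise the column labels in `Y-onto`.
  entering : ∀ {i} → 0 < X i → ∃[ c ] 0 < f i c × (∀ {i′} → 0 < f i′ c → X i ≤ X i′)
  entering {i} X>0 with X i in eq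
  ... | suc zero with X-inhabited (subst (0 <_) (sym eq) X>0)
  ...   | c , ic>0 = c , ic>0 , X-pos
  entering {i} X>0 | suc (suc v) with X-onto v (≤-trans (n≤1+n (suc v)) (subst (_≤ height) eq (X≤j i)))
  ...   | i₂ , eq₂ with X-witness {i₂} {i} (subst₂ _<_ (sym eq₂) (sym eq) ≤-refl)
  ...     | c , ic>0 , i₂c≡0 = c , ic>0 , λ {i′} i′c>0 → subst (_< X i′) eq₂
            (≰⇒> (λ X≤ → contradiction (subst (0 <_) i₂c≡0 (X-chain X≤ i′c>0)) λ ()))

  Y-onto : ∀ t → t < height → ∃[ c ] Y c ≡ suc t
  -- The row found has label `height - t`, the one diagonal to column label `t + 1`.
  Y-onto t t<j with X-onto (height ∸ suc t) (∸-monoʳ-< {o = 0} z<s t<j)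
  ... | i , eq with entering {i} (subst (0 <_) (sym eq) z<s)
  ... | c , ic>0 , least = c , ≤-antisym upper (subst (_≤ Y c) depth≡1+t (≤Y ic>0))
    where
    depth≡1+t : suc height ∸ X i ≡ suc t
    depth≡1+t = trans (cong (suc height ∸_) eq) (m∸[m∸n]≡n t<j)
    upper : Y c ≤ suc t
    upper with lowest {i} (positive ic>0)
    ... | i₀ , i₀c>0 , sum≡ = begin
      Y c               ≡⟨ m+n∸m≡n (X i₀) (Y c) ⟨
      X i₀ + Y c ∸ X i₀ ≡⟨ cong (_∸ X i₀) sum≡ ⟩
      suc height ∸ X i₀      ≤⟨ ∸-monoʳ-≤ (suc height) (least i₀c>0) ⟩
      suc height ∸ X i       ≡⟨ depth≡1+t ⟩
      suc t             ∎
      where open ≤-Reasoning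

  -- Above the diagonal, the lowest row positive in column `c` lacks some column of row `i`. That
  -- zero and the 1 at `(i , c)` would be the low corners of a switch.
  one-diagonal : ∀ {i c} → f i c ≡ 1 → X i + Y c ≡ suc height
  one-diagonal {i} {c} eq with m≤n⇒m<n∨m≡n (positive {i} {c} (subst (0 <_) (sym eq) z<s))
  ... | inj₂ sum≡ = sym sum≡
  ... | inj₁ above with lowest {i} {c} (<-trans (n<1+n height) above)
  ... | i₀ , i₀c>0 , sum≡ with X-witness {i₀} {i} X<
    where
    X< : X i₀ < X i
    X< = +-cancelʳ-< (Y c) (X i₀) (X i) (subst (_< X i + Y c) (sym sum≡) above)
  ... | c′ , ic′>0 , i₀c′≡0 = ⊥-elim (noSwitch {i₀} {i} {c} {c′}
          (λ { refl → contradiction (subst (0 <_) i₀c′≡0 ic′>0) λ () })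
          (λ { refl → contradiction (subst (0 <_) i₀c′≡0 i₀c>0) λ () })
          i₀c>0 ic′>0 (subst (_< 2) (sym i₀c′≡0) z<s) (subst (_< 2) (sym eq) ≤-refl))

  rowHasOne? : ∀ i → Dec (∃[ c ] f i c ≡ 1)
  rowHasOne? i = Fin.any? (λ c → f i c ≟ 1)

  colHasOne? : ∀ c → Dec (∃[ i ] f i c ≡ 1)
  colHasOne? c = Fin.any? (λ i → f i c ≟ 1)

  μ : Fin m → Bool
  μ i = ⌊ rowHasOne? i ⌋

  ν : Fin n → Bool
  ν c = ⌊ colHasOne? c ⌋

  -- Row `i` and column `c` each contain a 1, and these 1s span with `(i , c)` a rectangle inside
  -- one diagonal block. Were `f i c` equal to 2, they would be the low corners of a switch.
  one⁻ : ∀ {i c} → X i + Y c ≡ suc height → T (μ i) → T (ν c) → f i c ≡ 1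
  one⁻ {i} {c} sum≡ μi νc with toWitness {a? = rowHasOne? i} μi | toWitness {a? = colHasOne? c} νc | f i c <? 2
  ... | _ | _ | yes <2 = ≤-antisym (s≤s⁻¹ <2) (positive⁻ (≤-reflexive (sym sum≡)))
  ... | c′ , ic′ | i′ , i′c | no ≮2 = ⊥-elim (noSwitch {i} {i′} {c} {c′}
          (λ { refl → ≮2 (subst (_< 2) (sym i′c) ≤-refl) })
          (λ { refl → ≮2 (subst (_< 2) (sym ic′) ≤-refl) })
          (positive⁻ (≤-reflexive (sym sum≡))) (positive⁻ (≤-reflexive (sym i′c′)))
          (subst (_< 2) (sym ic′) ≤-refl) (subst (_< 2) (sym i′c) ≤-refl))
    where
    i′c′ : X i′ + Y c′ ≡ suc height
    i′c′ = trans (cong (_+ Y c′) (+-cancelʳ-≡ (Y c) (X i′) (X i) (trans (one-diagonal i′c) (sym sum≡)))) (one-diagonal ic′)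

  depicts : Depicts height X Y μ ν f
  depicts = record
    { positive  = positive
    ; positive⁻ = positive⁻
    ; one       = λ {i} {c} eq → one-diagonal eq , fromWitness {a? = rowHasOne? i} (c , eq) , fromWitness {a? = colHasOne? c} (i , eq)
    ; one⁻      = one⁻
    }

  layout : Layout height X Y μ ν
  layout = record
    { X≤j = X≤j ; Y≤j = Y≤j ; X-onto = X-onto ; Y-onto = Y-onto
    ; partnerˣ = λ i μi → let c , eq = toWitness {a? = rowHasOne? i} μi in
        c , fromWitness {a? = colHasOne? c} (i , eq) , one-diagonal eq
    ; partnerʸ = λ c νc → let i , eq = toWitness {a? = colHasOne? c} νc in
        i , fromWitness {a? = rowHasOne? i} (c , eq) , one-diagonal eq
    -- All four cells would be 1, and a square of four 1s is itself a switch.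
    ; thin = λ {i} {i′} {c} {c′} i≢i′ c≢c′ μi μi′ νc νc′ ic i′c ic′ →
        let i′c′ = trans (cong (_+ Y c′) (+-cancelʳ-≡ (Y c) (X i′) (X i) (trans i′c (sym ic)))) ic′ in
        noSwitch i≢i′ c≢c′
          (positive⁻ (≤-reflexive (sym ic))) (positive⁻ (≤-reflexive (sym i′c′)))
          (subst (_< 2) (sym (one⁻ ic′ μi νc′)) ≤-refl) (subst (_< 2) (sym (one⁻ i′c μi′ νc)) ≤-refl)
    }

-- Counting words by their content

sumOver : List A → (A → ℕ) → ℕ
sumOver xs f = lsum (List.map f xs)

sumOver-cong : (xs : List A) {f g : A → ℕ} → (∀ x → f x ≡ g x) → sumOver xs f ≡ sumOver xs g
sumOver-cong xs eq = cong lsum (List.map-cong eq xs)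

sumOver-map : (xs : List A) (g : A → B) (f : B → ℕ) → sumOver (List.map g xs) f ≡ sumOver xs (f ∘ g)
sumOver-map xs g f = cong lsum (sym (List.map-∘ xs))

sumOver-++ : (xs ys : List A) (f : A → ℕ) → sumOver (xs ++ ys) f ≡ sumOver xs f + sumOver ys f
sumOver-++ []       ys f = refl
sumOver-++ (x ∷ xs) ys f = trans (cong (f x +_) (sumOver-++ xs ys f)) (sym (+-assoc (f x) _ _))

sumOver-concatMap : (xs : List A) (g : A → List B) (f : B → ℕ) →
                    sumOver (concatMap g xs) f ≡ sumOver xs (λ x → sumOver (g x) f)
sumOver-concatMap []       g f = refl
sumOver-concatMap (x ∷ xs) g f = trans (sumOver-++ (g x) (concatMap g xs) f)
                                       (cong (sumOver (g x) f +_) (sumOver-concatMap xs g f))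

sumOver-+ : (xs : List A) (f g : A → ℕ) → sumOver xs (λ x → f x + g x) ≡ sumOver xs f + sumOver xs g
sumOver-+ []       f g = refl
sumOver-+ (x ∷ xs) f g = trans (cong (f x + g x +_) (sumOver-+ xs f g)) (lemma (f x) (g x) _ _)
  where
  lemma : ∀ a b c d → a + b + (c + d) ≡ a + c + (b + d)
  lemma = solve-∀

sumOver-*ˡ : (xs : List A) (a : ℕ) (f : A → ℕ) → sumOver xs (λ x → a * f x) ≡ a * sumOver xs f
sumOver-*ˡ []       a f = sym (*-zeroʳ a)
sumOver-*ˡ (x ∷ xs) a f = trans (cong (a * f x +_) (sumOver-*ˡ xs a f)) (sym (*-distribˡ-+ a (f x) _))

sumOver-upTo : ∀ l (f : ℕ → ℕ) → sumOver (upTo (suc l)) f ≡ f 0 + sumOver (upTo l) (f ∘ suc)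
sumOver-upTo l f = cong (λ xs → f 0 + lsum xs)
  (trans (List.map-applyUpTo suc f l) (sym (List.map-applyUpTo id (f ∘ suc) l)))

sumOver-allFin : ∀ k (f : Fin (suc k) → ℕ) → sumOver (allFin (suc k)) f ≡ f zero + sumOver (allFin k) (f ∘ suc)
sumOver-allFin k f = cong (λ xs → f zero + lsum xs)
  (trans (List.map-tabulate suc f) (sym (List.map-tabulate id (f ∘ suc))))

⟦_⟧ : Bool → ℕ
⟦ true  ⟧ = 1
⟦ false ⟧ = 0

⟦∧⟧ : ∀ a b → ⟦ a ∧ b ⟧ ≡ ⟦ a ⟧ * ⟦ b ⟧
⟦∧⟧ true  b = sym (*-identityˡ ⟦ b ⟧)
⟦∧⟧ false b = refl

sumOver-filterᵇ : (p : A → Bool) (xs : List A) (f : A → ℕ) →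
                  sumOver (filterᵇ p xs) f ≡ sumOver xs (λ x → ⟦ p x ⟧ * f x)
sumOver-filterᵇ p []       f = refl
sumOver-filterᵇ p (x ∷ xs) f with p x
... | true  = cong₂ _+_ (sym (*-identityˡ (f x))) (sumOver-filterᵇ p xs f)
... | false = sumOver-filterᵇ p xs f

length-filterᵇ : (p : A → Bool) (xs : List A) → length (filterᵇ p xs) ≡ sumOver xs (⟦_⟧ ∘ p)
length-filterᵇ p []       = refl
length-filterᵇ p (x ∷ xs) with p x
... | true  = cong suc (length-filterᵇ p xs)
... | false = length-filterᵇ p xs

words : List A → ∀ n → List (Vec A n)
words xs zero    = List.[ [] ]
words xs (suc n) = concatMap (λ x → List.map (x ∷_) (words xs n)) xs

sumOver-prepend : (xs : List A) (yss : List (Vec A n)) (f : Vec A (suc n) → ℕ) →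
                  sumOver (concatMap (λ x → List.map (x ∷_) yss) xs) f ≡ sumOver xs (λ x → sumOver yss (f ∘ (x ∷_)))
sumOver-prepend xs yss f = trans (sumOver-concatMap xs _ f) (sumOver-cong xs (λ x → sumOver-map yss (x ∷_) f))

bump : Bool → Fin k → Vec ℕ k → Vec ℕ k
bump true  t v = updateAt v t suc
bump false t v = v

tally : Vec (Fin k) m → Vec Bool m → Vec ℕ k
tally []      []      = replicate _ 0
tally (t ∷ p) (b ∷ w) = bump b t (tally p w)

content : Vec (Fin k) m → Vec ℕ k
content p = tally p (replicate _ true)

weight : Vec (ℕ → ℕ) k → Vec ℕ k → ℕ
weight hs v = vprod (zipWith (λ a h → h a) v hs)

-- By Pascal's rule, pascal h r = Σ_a C(r,a) h(a).
pascal : (ℕ → ℕ) → ℕ → ℕ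
pascal h zero    = h 0
pascal h (suc r) = pascal h r + pascal (h ∘ suc) r

weight-bump : (hs : Vec (ℕ → ℕ) k) (v : Vec ℕ k) (t : Fin k) →
              weight hs (updateAt v t suc) ≡ weight (updateAt hs t (_∘ suc)) v
weight-bump (h ∷ hs) (a ∷ v) zero    = refl
weight-bump (h ∷ hs) (a ∷ v) (suc t) = cong (h a *_) (weight-bump hs v t)

weight-pascal-bump : (hs : Vec (ℕ → ℕ) k) (v : Vec ℕ k) (t : Fin k) →
  weight (map pascal hs) (updateAt v t suc) ≡ weight (map pascal hs) v + weight (map pascal (updateAt hs t (_∘ suc))) v
weight-pascal-bump (h ∷ hs) (a ∷ v) zero    = *-distribʳ-+ (weight (map pascal hs) v) (pascal h a) (pascal (h ∘ suc) a)
weight-pascal-bump (h ∷ hs) (a ∷ v) (suc t) =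
  trans (cong (pascal h a *_) (weight-pascal-bump hs v t)) (*-distribˡ-+ (pascal h a) _ _)

bools : List Bool
bools = false ∷ true ∷ []

weight-replicate : ∀ k (hs : Vec (ℕ → ℕ) k) → weight hs (replicate k 0) ≡ weight (map pascal hs) (replicate k 0)
weight-replicate zero    []       = refl
weight-replicate (suc k) (h ∷ hs) = cong (h 0 *_) (weight-replicate k hs)

-- Leaving a position of label `t` unmarked keeps the weight of `t`, marking it shifts the weight;
-- these are the two summands in the recursion of `pascal`. The sum over markings therefore factors
-- over the labels.
sumOver-marks : (p : Vec (Fin k) m) (hs : Vec (ℕ → ℕ) k) →
                sumOver (words bools m) (weight hs ∘ tally p) ≡ weight (map pascal hs) (content p)
sumOver-marks {k = k} [] hs = trans (+-identityʳ _) (weight-replicate k hs)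
sumOver-marks {m = suc m} (t ∷ p) hs = begin
  sumOver (words bools (suc m)) (weight hs ∘ tally (t ∷ p))
    ≡⟨ sumOver-prepend bools (words bools m) _ ⟩
  sumOver (words bools m) (weight hs ∘ tally p) + (sumOver (words bools m) (λ w → weight hs (updateAt (tally p w) t suc)) + 0)
    ≡⟨ cong (sumOver (words bools m) (weight hs ∘ tally p) +_)
         (trans (+-identityʳ _) (sumOver-cong (words bools m) (λ w → weight-bump hs (tally p w) t))) ⟩
  sumOver (words bools m) (weight hs ∘ tally p) + sumOver (words bools m) (weight (updateAt hs t (_∘ suc)) ∘ tally p)
    ≡⟨ cong₂ _+_ (sumOver-marks p hs) (sumOver-marks p (updateAt hs t (_∘ suc))) ⟩
  weight (map pascal hs) (content p) + weight (map pascal (updateAt hs t (_∘ suc))) (content p)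
    ≡⟨ weight-pascal-bump hs (content p) t ⟨
  weight (map pascal hs) (content (t ∷ p)) ∎
  where open ≡-Reasoning

sumOver-marks-zipWith : (g : B → ℕ → ℕ) (h₀ : ℕ → ℕ) (p : Vec (Fin (suc j)) m) (ys : Vec B j) →
  sumOver (words bools m) (λ w → weight (h₀ ∷ map g ys) (tally p w)) ≡
  weight (pascal h₀ ∷ map (pascal ∘ g) ys) (content p)
sumOver-marks-zipWith g h₀ p ys = trans (sumOver-marks p (h₀ ∷ map g ys))
  (cong (λ hs → weight (pascal h₀ ∷ hs) (content p)) (sym (Vec.map-∘ pascal g ys)))

-- Binomial sums of the block conditions

pascal-cong : ∀ {h h′} → (∀ a → h a ≡ h′ a) → ∀ r → pascal h r ≡ pascal h′ r
pascal-cong eq zero    = eq 0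
pascal-cong eq (suc r) = cong₂ _+_ (pascal-cong eq r) (pascal-cong (eq ∘ suc) r)

pascal-const : ∀ h c → (∀ a → h a ≡ c) → ∀ r → pascal h r ≡ c * 2 ^ r
pascal-const h c eq zero    = trans (eq 0) (sym (*-identityʳ c))
pascal-const h c eq (suc r) =
  trans (cong₂ _+_ (pascal-const h c eq r) (pascal-const (h ∘ suc) c (eq ∘ suc) r)) (lemma c (2 ^ r))
  where
  lemma : ∀ c x → c * x + c * x ≡ c * (2 * x)
  lemma = solve-∀

pascal-stable₁ : ∀ h c → (∀ a → h (suc a) ≡ c) → ∀ r → pascal h r + c ≡ h 0 + c * 2 ^ r
pascal-stable₁ h c eq zero    = cong (h 0 +_) (sym (*-identityʳ c))
pascal-stable₁ h c eq (suc r) = begin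
  pascal h r + pascal (h ∘ suc) r + c  ≡⟨ lemma₁ (pascal h r) (pascal (h ∘ suc) r) c ⟩
  pascal h r + c + pascal (h ∘ suc) r  ≡⟨ cong₂ _+_ (pascal-stable₁ h c eq r) (pascal-const (h ∘ suc) c eq r) ⟩
  h 0 + c * 2 ^ r + c * 2 ^ r          ≡⟨ lemma₂ (h 0) c (2 ^ r) ⟩
  h 0 + c * 2 ^ suc r                  ∎
  where
  open ≡-Reasoning
  lemma₁ : ∀ x y c → x + y + c ≡ x + c + y
  lemma₁ = solve-∀
  lemma₂ : ∀ a c x → a + c * x + c * x ≡ a + c * (2 * x)
  lemma₂ = solve-∀

-- Compared with a constant sequence only the terms at 0 and 1 change, with binomial coefficients 1
-- and `r`; they are added on the left to avoid subtraction. The block indicators below are all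
-- constant from index 2 on.
pascal-stable₂ : ∀ h c → (∀ a → h (suc (suc a)) ≡ c) → ∀ r →
                 pascal h r + c * (1 + r) ≡ h 0 + r * h 1 + c * 2 ^ r
pascal-stable₂ h c eq zero    = cong (_+ c * 1) (sym (+-identityʳ (h 0)))
pascal-stable₂ h c eq (suc r) = begin
  pascal h r + pascal (h ∘ suc) r + c * (2 + r)        ≡⟨ lemma₁ (pascal h r) (pascal (h ∘ suc) r) c r ⟩
  pascal h r + c * (1 + r) + (pascal (h ∘ suc) r + c)  ≡⟨ cong₂ _+_ (pascal-stable₂ h c eq r) (pascal-stable₁ (h ∘ suc) c eq r) ⟩
  h 0 + r * h 1 + c * 2 ^ r + (h 1 + c * 2 ^ r)        ≡⟨ lemma₂ (h 0) (h 1) c r (2 ^ r) ⟩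
  h 0 + suc r * h 1 + c * 2 ^ suc r                    ∎
  where
  open ≡-Reasoning
  lemma₁ : ∀ x y c r → x + y + c * (2 + r) ≡ x + c * (1 + r) + (y + c)
  lemma₁ = solve-∀
  lemma₂ : ∀ a b c r x → a + r * b + c * x + (b + c * x) ≡ a + (1 + r) * b + c * (2 * x)
  lemma₂ = solve-∀

isZero : ℕ → Bool
isZero zero    = true
isZero (suc _) = false

-- The possible numbers of marked rows and marked columns of a diagonal block.
isStar : ℕ → ℕ → Bool
isStar zero          b             = isZero b
isStar (suc a)       zero          = false
isStar (suc zero)    (suc b)       = true
isStar (suc (suc a)) (suc zero)    = true
isStar (suc (suc a)) (suc (suc b)) = false

pascal-isZero : ∀ r → pascal (⟦_⟧ ∘ isZero) r ≡ 1
pascal-isZero r = trans (sym (+-identityʳ _)) (pascal-stable₁ (⟦_⟧ ∘ isZero) 0 (λ _ → refl) r)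

-- For 0, 1 or more marked columns the admissible sets of marked rows number 1, `2 ^ r - 1` and `r`.
-- The four terms of `f3` are: no marks, one row with one column, one row with several columns,
-- several rows with one column.
pascal-isStar : ∀ r s → pascal (λ b → pascal (λ a → ⟦ isStar a b ⟧) r) s ≡ f3 r s
pascal-isStar r s = +-cancelʳ-≡ (r * (1 + s)) _ _ (begin
  pascal inner s + r * (1 + s)           ≡⟨ pascal-stable₂ inner r many s ⟩
  inner 0 + s * inner 1 + r * 2 ^ s      ≡⟨ cong₂ (λ x y → x + s * y + r * 2 ^ s) none single ⟩
  1 + s * (r + Q r) + r * 2 ^ s          ≡⟨ cong (λ x → 1 + s * (r + Q r) + r * x) (2^≡ s) ⟩
  1 + s * (r + Q r) + r * (1 + s + Q s)  ≡⟨ lemma r s (Q r) (Q s) ⟩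
  f3 r s + r * (1 + s)                   ∎)
  where
  open ≡-Reasoning
  inner : ℕ → ℕ
  inner b = pascal (λ a → ⟦ isStar a b ⟧) r
  Q : ℕ → ℕ
  Q x = 2 ^ x ∸ x ∸ 1
  n<2^n : ∀ x → x < 2 ^ x
  n<2^n zero    = z<s
  n<2^n (suc x) = subst (suc (suc x) ≤_) (cong (2 ^ x +_) (sym (+-identityʳ _)))
                    (+-mono-≤ (≤-trans (s≤s z≤n) (n<2^n x)) (n<2^n x))
  2^≡ : ∀ x → 2 ^ x ≡ 1 + x + Q x
  2^≡ x = sym (trans (cong (1 + x +_) (trans (∸-+-assoc (2 ^ x) x 1) (cong (2 ^ x ∸_) (+-comm x 1)))) (m+[n∸m]≡n (n<2^n x)))
  none : inner 0 ≡ 1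
  none = trans (pascal-cong {h′ = ⟦_⟧ ∘ isZero} (λ { zero → refl ; (suc a) → refl }) r) (pascal-isZero r)
  single : inner 1 ≡ r + Q r
  single = suc-injective (trans (trans (+-comm 1 (inner 1))
    (trans (pascal-stable₁ (λ a → ⟦ isStar a 1 ⟧) 1 (λ { zero → refl ; (suc a) → refl }) r) (*-identityˡ (2 ^ r)))) (2^≡ r))
  many : ∀ b → inner (suc (suc b)) ≡ r
  many b = trans (sym (+-identityʳ _)) (trans (pascal-stable₂ (λ a → ⟦ isStar a (suc (suc b)) ⟧) 0 (λ _ → refl) r)
    (trans (+-identityʳ _) (*-identityʳ r)))
  lemma : ∀ r s u v → 1 + s * (r + u) + r * (1 + s + v) ≡ 1 + r * s + r * v + s * u + r * (1 + s)
  lemma = solve-∀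

vprod-∷ʳ : (f : A → B → ℕ) (xs : Vec A n) (ys : Vec B n) (x : A) (y : B) →
           vprod (zipWith f (xs ∷ʳ x) (ys ∷ʳ y)) ≡ f x y * vprod (zipWith f xs ys)
vprod-∷ʳ f []        []        x y = refl
vprod-∷ʳ f (x′ ∷ xs) (y′ ∷ ys) x y =
  trans (cong (f x′ y′ *_) (vprod-∷ʳ f xs ys x y)) (lemma (f x′ y′) (f x y) _)
  where
  lemma : ∀ a b c → a * (b * c) ≡ b * (a * c)
  lemma = solve-∀

vprod-reverse : (f : A → B → ℕ) (xs : Vec A n) (ys : Vec B n) →
                vprod (zipWith f (reverse xs) (reverse ys)) ≡ vprod (zipWith f xs ys)
vprod-reverse f []       []       = refl
vprod-reverse f (x ∷ xs) (y ∷ ys) rewrite Vec.reverse-∷ x xs | Vec.reverse-∷ y ys =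
  trans (vprod-∷ʳ f (reverse xs) (reverse ys) x y) (cong (f x y *_) (vprod-reverse f xs ys))

-- Reversing both vectors only permutes the factors. This moves the reversal to the other side when
-- the summation passes from row marks to column marks.
vprod-flip : (f : A → B → ℕ) (xs : Vec A n) (ys : Vec B n) →
             vprod (zipWith f xs (reverse ys)) ≡ vprod (zipWith (flip f) ys (reverse xs))
vprod-flip f xs ys = begin
  vprod (zipWith f xs (reverse ys))                      ≡⟨ vprod-reverse f xs (reverse ys) ⟨
  vprod (zipWith f (reverse xs) (reverse (reverse ys)))  ≡⟨ cong (vprod ∘ zipWith f (reverse xs)) (Vec.reverse-involutive ys) ⟩
  vprod (zipWith f (reverse xs) ys)                      ≡⟨ cong vprod (Vec.zipWith-comm (λ x y → refl) (reverse xs) ys) ⟩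
  vprod (zipWith (flip f) ys (reverse xs))               ∎
  where open ≡-Reasoning

-- Multinomial coefficients as numbers of words

wordSum : ∀ k m → (Vec ℕ k → ℕ) → ℕ
wordSum k m H = sumOver (words (allFin k) m) (H ∘ content)

wordSum-cong : ∀ k m {H H′ : Vec ℕ k → ℕ} → (∀ v → H v ≡ H′ v) → wordSum k m H ≡ wordSum k m H′
wordSum-cong k m eq = sumOver-cong (words (allFin k) m) (eq ∘ content)

wordSum-suc : ∀ k m H → wordSum k (suc m) H ≡ sumOver (allFin k) (λ t → wordSum k m (λ v → H (updateAt v t suc)))
wordSum-suc k m H = sumOver-prepend (allFin k) (words (allFin k) m) (H ∘ content)

-- Each of `m` positions chooses one of two classes, of final sizes `x` and `y`. The classes will be
-- label 0 and all other labels.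
splits : ∀ (m : ℕ) → (ℕ → ℕ → ℕ) → ℕ
splits zero    G = G 0 0
splits (suc m) G = splits m (λ x y → G (suc x) y) + splits m (λ x y → G x (suc y))

splits-cong : ∀ (m : ℕ) {G G′ : ℕ → ℕ → ℕ} → (∀ x y → G x y ≡ G′ x y) → splits m G ≡ splits m G′
splits-cong zero    eq = eq 0 0
splits-cong (suc m) eq = cong₂ _+_ (splits-cong m (λ x y → eq (suc x) y)) (splits-cong m (λ x y → eq x (suc y)))

sumOver-splits : (xs : List A) (m : ℕ) (G : A → ℕ → ℕ → ℕ) →
                 sumOver xs (λ t → splits m (G t)) ≡ splits m (λ x y → sumOver xs (λ t → G t x y))
sumOver-splits xs zero    G = refl
sumOver-splits xs (suc m) G = trans (sumOver-+ xs (λ t → splits m (λ x y → G t (suc x) y)) (λ t → splits m (λ x y → G t x (suc y))))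
  (cong₂ _+_ (sumOver-splits xs m (λ t x y → G t (suc x) y)) (sumOver-splits xs m (λ t x y → G t x (suc y))))

wordSum-splits : ∀ k m H → wordSum (suc k) m H ≡ splits m (λ x y → wordSum k y (λ v → H (x ∷ v)))
wordSum-splits k zero    H = refl
wordSum-splits k (suc m) H = begin
  wordSum (suc k) (suc m) H
    ≡⟨ wordSum-suc (suc k) m H ⟩
  sumOver (allFin (suc k)) (λ t → wordSum (suc k) m (λ v → H (updateAt v t suc)))
    ≡⟨ sumOver-allFin k _ ⟩
  wordSum (suc k) m (λ v → H (updateAt v zero suc)) + sumOver (allFin k) (λ t → wordSum (suc k) m (λ v → H (updateAt v (suc t) suc)))
    ≡⟨ cong₂ _+_ (wordSum-splits k m (λ v → H (updateAt v zero suc)))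
         (sumOver-cong (allFin k) (λ t → wordSum-splits k m (λ v → H (updateAt v (suc t) suc)))) ⟩
  splits m (λ x y → wordSum k y (λ v → H (suc x ∷ v))) +
    sumOver (allFin k) (λ t → splits m (λ x y → wordSum k y (λ v → H (x ∷ updateAt v t suc))))
    ≡⟨ cong (splits m (λ x y → wordSum k y (λ v → H (suc x ∷ v))) +_)
         (trans (sumOver-splits (allFin k) m (λ t x y → wordSum k y (λ v → H (x ∷ updateAt v t suc)))) (splits-cong m (λ x y → sym (wordSum-suc k y (λ v → H (x ∷ v)))))) ⟩
  splits (suc m) (λ x y → wordSum k y (λ v → H (x ∷ v))) ∎
  where open ≡-Reasoning

-- The range may exceed `m`, where the coefficients vanish. This freedom is needed because
-- `allVecs l` keeps the same bound for all components while the remaining total shrinks.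
splits-binomial : ∀ {m l} → m ≤ l → (G : ℕ → ℕ → ℕ) →
                  splits m G ≡ sumOver (upTo (suc l)) (λ x → (m C x) * G x (m ∸ x))
splits-binomial {zero} {l} z≤n G = begin
  G 0 0                                                           ≡⟨ +-identityʳ (G 0 0) ⟨
  G 0 0 + 0                                                       ≡⟨ cong₂ _+_ (sym (*-identityˡ (G 0 0))) (sym rest) ⟩
  1 * G 0 0 + sumOver (upTo l) (λ x → (0 C suc x) * G (suc x) 0)  ≡⟨ sumOver-upTo l (λ x → (0 C x) * G x (0 ∸ x)) ⟨
  sumOver (upTo (suc l)) (λ x → (0 C x) * G x (0 ∸ x))            ∎
  where
  open ≡-Reasoning
  rest : sumOver (upTo l) (λ x → (0 C suc x) * G (suc x) 0) ≡ 0
  rest = sumOver-*ˡ (upTo l) 0 (λ x → G (suc x) 0)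
splits-binomial {suc m} {suc l} (s≤s m≤l) G = begin
  splits m (λ x y → G (suc x) y) + splits m (λ x y → G x (suc y))
    ≡⟨ cong₂ _+_ (splits-binomial m≤l (λ x y → G (suc x) y)) (splits-binomial (m≤n⇒m≤1+n m≤l) (λ x y → G x (suc y))) ⟩
  sumOver (upTo (suc l)) (λ x → (m C x) * G (suc x) (m ∸ x)) + sumOver (upTo (suc (suc l))) (λ x → (m C x) * G x (suc (m ∸ x)))
    ≡⟨ cong (first +_) (sumOver-upTo (suc l) (λ x → (m C x) * G x (suc (m ∸ x)))) ⟩
  first + ((m C 0) * G 0 (suc m) + sumOver (upTo (suc l)) (λ x → (m C suc x) * G (suc x) (suc (m ∸ suc x))))
    ≡⟨ lemma first ((m C 0) * G 0 (suc m)) _ ⟩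
  (m C 0) * G 0 (suc m) + (first + sumOver (upTo (suc l)) (λ x → (m C suc x) * G (suc x) (suc (m ∸ suc x))))
    ≡⟨ cong ((m C 0) * G 0 (suc m) +_)
         (trans (sym (sumOver-+ (upTo (suc l)) (λ x → (m C x) * G (suc x) (m ∸ x)) (λ x → (m C suc x) * G (suc x) (suc (m ∸ suc x))))) (sumOver-cong (upTo (suc l)) combine)) ⟩
  (suc m C 0) * G 0 (suc m) + sumOver (upTo (suc l)) (λ x → (suc m C suc x) * G (suc x) (m ∸ x))
    ≡⟨ sumOver-upTo (suc l) (λ x → (suc m C x) * G x (suc m ∸ x)) ⟨
  sumOver (upTo (suc (suc l))) (λ x → (suc m C x) * G x (suc m ∸ x)) ∎
  where
  open ≡-Reasoning
  first : ℕ
  first = sumOver (upTo (suc l)) (λ x → (m C x) * G (suc x) (m ∸ x))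
  lemma : ∀ a b c → a + (b + c) ≡ b + (a + c)
  lemma = solve-∀
  -- For `x ≥ m` the two truncated differences disagree, but the coefficient `m C suc x` is 0.
  shift : ∀ x → (m C suc x) * G (suc x) (suc (m ∸ suc x)) ≡ (m C suc x) * G (suc x) (m ∸ x)
  shift x with suc x ≤? m
  ... | yes x<m = cong (λ y → (m C suc x) * G (suc x) y) (sym (+-∸-assoc 1 x<m))
  ... | no  x≮m rewrite k>n⇒nCk≡0 (≰⇒> x≮m) = refl
  combine : ∀ x → (m C x) * G (suc x) (m ∸ x) + (m C suc x) * G (suc x) (suc (m ∸ suc x)) ≡ (suc m C suc x) * G (suc x) (m ∸ x)
  combine x = trans (cong ((m C x) * G (suc x) (m ∸ x) +_) (shift x))
    (trans (sym (*-distribʳ-+ (G (suc x) (m ∸ x)) (m C x) (m C suc x)))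
      (cong (_* G (suc x) (m ∸ x)) (nCk+nC[k+1]≡[n+1]C[k+1] m x)))

multinomial-unique : ∀ m (v : Vec ℕ k) q → q * factProd v ≡ m ! → multinomial m v ≡ q
multinomial-unique m v q eq rewrite sym eq = m*n/n≡m q (factProd v) {{factProd≢0 v}}

nCk*k![n∸k]! : ∀ {n k} → k ≤ n → (n C k) * (k ! * (n ∸ k) !) ≡ n !
nCk*k![n∸k]! {n} {k} k≤n = trans (cong (_* (k ! * (n ∸ k) !)) (nCk≡n!/k![n-k]! k≤n))
  (m/n*n≡m {{m*n≢0 (k !) ((n ∸ k) !) {{k !≢0}} {{(n ∸ k) !≢0}}}} (k![n∸k]!∣n! k≤n))

binomial-factProd : ∀ x (v : Vec ℕ k) q → q * factProd v ≡ vsum v ! →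
                    ((x + vsum v) C x) * q * factProd (x ∷ v) ≡ (x + vsum v) !
binomial-factProd x v q eq = begin
  ((x + vsum v) C x) * q * (x ! * factProd v)      ≡⟨ lemma ((x + vsum v) C x) q (x !) (factProd v) ⟩
  ((x + vsum v) C x) * (x ! * (q * factProd v))    ≡⟨ cong (λ y → ((x + vsum v) C x) * (x ! * y)) eq ⟩
  ((x + vsum v) C x) * (x ! * vsum v !)            ≡⟨ cong (λ y → ((x + vsum v) C x) * (x ! * y !)) (m+n∸m≡n x (vsum v)) ⟨
  ((x + vsum v) C x) * (x ! * (x + vsum v ∸ x) !)  ≡⟨ nCk*k![n∸k]! (m≤m+n x (vsum v)) ⟩
  (x + vsum v) !                                   ∎
  where
  open ≡-Reasoning
  lemma : ∀ c w a b → c * w * (a * b) ≡ c * (a * (w * b))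
  lemma = solve-∀

-- The coefficient is defined as a rounded quotient, so exactness needs proof. The binomial
-- recursion supplies an integer that solves the defining equation, and the quotient must equal it.
multinomial-exact : (v : Vec ℕ k) → multinomial (vsum v) v * factProd v ≡ vsum v !
multinomial-∷ : ∀ x (v : Vec ℕ k) → multinomial (x + vsum v) (x ∷ v) ≡ ((x + vsum v) C x) * multinomial (vsum v) v

multinomial-exact []      = refl
multinomial-exact (x ∷ v) = trans (cong (_* factProd (x ∷ v)) (multinomial-∷ x v))
                                  (binomial-factProd x v _ (multinomial-exact v))

multinomial-∷ x v = multinomial-unique (x + vsum v) (x ∷ v) _ (binomial-factProd x v _ (multinomial-exact v))

_≈ᵇ_ : ℕ → ℕ → Bool
a ≈ᵇ b = (a ≤ᵇ b) ∧ (b ≤ᵇ a)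

T⇒1 : ∀ {b} → T b → ⟦ b ⟧ ≡ 1
T⇒1 {true} _ = refl

¬T⇒0 : ∀ {b} → ¬ T b → ⟦ b ⟧ ≡ 0
¬T⇒0 {true}  ¬t = contradiction _ ¬t
¬T⇒0 {false} _  = refl

≈ᵇ-refl : ∀ a → ⟦ a ≈ᵇ a ⟧ ≡ 1
≈ᵇ-refl a = trans (⟦∧⟧ (a ≤ᵇ a) (a ≤ᵇ a)) (cong₂ _*_ (T⇒1 (≤⇒≤ᵇ (≤-refl {a}))) (T⇒1 (≤⇒≤ᵇ (≤-refl {a}))))

≈ᵇ-≢ : ∀ {a b} → a ≢ b → ⟦ a ≈ᵇ b ⟧ ≡ 0
≈ᵇ-≢ {a} {b} a≢b with a ≤? b
... | yes a≤b = trans (⟦∧⟧ (a ≤ᵇ b) (b ≤ᵇ a)) (trans (cong (⟦ a ≤ᵇ b ⟧ *_)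
                  (¬T⇒0 (λ t → a≢b (≤-antisym a≤b (≤ᵇ⇒≤ b a t))))) (*-zeroʳ ⟦ a ≤ᵇ b ⟧))
... | no  a≰b = trans (⟦∧⟧ (a ≤ᵇ b) (b ≤ᵇ a)) (cong (_* ⟦ b ≤ᵇ a ⟧) (¬T⇒0 (λ t → a≰b (≤ᵇ⇒≤ a b t))))

peel : ∀ m x (v : Vec ℕ k) → ⟦ (x + vsum v) ≈ᵇ m ⟧ * multinomial m (x ∷ v) ≡
                             (m C x) * (⟦ vsum v ≈ᵇ (m ∸ x) ⟧ * multinomial (m ∸ x) v)
peel m x v with x + vsum v ≟ m
... | yes refl = begin
  ⟦ m′ ≈ᵇ m′ ⟧ * multinomial m′ (x ∷ v)                         ≡⟨ cong₂ _*_ (≈ᵇ-refl m′) (multinomial-∷ x v) ⟩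
  1 * ((m′ C x) * multinomial (vsum v) v)                       ≡⟨ *-identityˡ _ ⟩
  (m′ C x) * multinomial (vsum v) v                             ≡⟨ cong ((m′ C x) *_) (*-identityˡ _) ⟨
  (m′ C x) * (1 * multinomial (vsum v) v)                       ≡⟨ cong (λ y → (m′ C x) * (y * multinomial (vsum v) v)) (≈ᵇ-refl (vsum v)) ⟨
  (m′ C x) * (⟦ vsum v ≈ᵇ vsum v ⟧ * multinomial (vsum v) v)    ≡⟨ cong (λ y → (m′ C x) * (⟦ vsum v ≈ᵇ y ⟧ * multinomial y v)) (m+n∸m≡n x (vsum v)) ⟨
  (m′ C x) * (⟦ vsum v ≈ᵇ (m′ ∸ x) ⟧ * multinomial (m′ ∸ x) v)  ∎
  where
  open ≡-Reasoning
  m′ : ℕ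
  m′ = x + vsum v
... | no ≢m with x ≤? m
-- Here `m ∸ x` is truncated to 0 and may equal `vsum v`; the binomial coefficient makes the right
-- side 0 all the same.
... | no x≰m rewrite k>n⇒nCk≡0 (≰⇒> x≰m) | ≈ᵇ-≢ ≢m = refl
... | yes x≤m rewrite ≈ᵇ-≢ ≢m | ≈ᵇ-≢ {vsum v} {m ∸ x} (λ eq → ≢m (trans (cong (x +_) eq) (m+[n∸m]≡n x≤m))) =
  sym (*-zeroʳ (m C x))

-- Both sides obey one recursion on the number of labels: peeling off the first component of the
-- vector corresponds to choosing the positions that carry label 0.
contentSum : ∀ {l} k m → m ≤ l → (H : Vec ℕ k → ℕ) →
             sumOver (allVecs l k) (λ v → ⟦ vsum v ≈ᵇ m ⟧ * multinomial m v * H v) ≡ wordSum k m H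
contentSum zero    zero    _ H = cong (_+ 0) (*-identityˡ (H []))
contentSum zero    (suc m) _ H = refl
contentSum {l} (suc k) m m≤l H = begin
  sumOver (allVecs l (suc k)) (λ v → ⟦ vsum v ≈ᵇ m ⟧ * multinomial m v * H v)
    ≡⟨ sumOver-prepend (upTo (suc l)) (allVecs l k) _ ⟩
  sumOver (upTo (suc l)) (λ x → sumOver (allVecs l k) (λ v → ⟦ (x + vsum v) ≈ᵇ m ⟧ * multinomial m (x ∷ v) * H (x ∷ v)))
    ≡⟨ sumOver-cong (upTo (suc l)) (λ x → trans
         (sumOver-cong (allVecs l k) (λ v → trans (cong (_* H (x ∷ v)) (peel m x v)) (*-assoc (m C x) _ (H (x ∷ v)))))
         (trans (sumOver-*ˡ (allVecs l k) (m C x) _)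
           (cong ((m C x) *_) (contentSum k (m ∸ x) (≤-trans (m∸n≤m m x) m≤l) (λ v → H (x ∷ v)))))) ⟩
  sumOver (upTo (suc l)) (λ x → (m C x) * wordSum k (m ∸ x) (λ v → H (x ∷ v)))
    ≡⟨ splits-binomial m≤l (λ x y → wordSum k y (λ v → H (x ∷ v))) ⟨
  splits m (λ x y → wordSum k y (λ v → H (x ∷ v)))
    ≡⟨ wordSum-splits k m H ⟨
  wordSum (suc k) m H ∎
  where open ≡-Reasoning

sumOver-S : ∀ m j (K : Vec ℕ (suc j) → ℕ) →
            sumOver (S m j) (λ v → multinomial m v * K v) ≡ wordSum (suc j) m (λ v → ⟦ allPos (tail v) ⟧ * K v)
sumOver-S m j K = begin
  sumOver (S m j) (λ v → multinomial m v * K v)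
    ≡⟨ sumOver-filterᵇ (isS m) (allVecs m (suc j)) _ ⟩
  sumOver (allVecs m (suc j)) (λ v → ⟦ isS m v ⟧ * (multinomial m v * K v))
    ≡⟨ sumOver-cong (allVecs m (suc j)) regroup ⟩
  sumOver (allVecs m (suc j)) (λ v → ⟦ vsum v ≈ᵇ m ⟧ * multinomial m v * (⟦ allPos (tail v) ⟧ * K v))
    ≡⟨ contentSum (suc j) m ≤-refl _ ⟩
  wordSum (suc j) m (λ v → ⟦ allPos (tail v) ⟧ * K v) ∎
  where
  open ≡-Reasoning
  lemma : ∀ a b c d → a * b * (c * d) ≡ b * c * (a * d)
  lemma = solve-∀
  regroup : ∀ v → ⟦ isS m v ⟧ * (multinomial m v * K v) ≡ ⟦ vsum v ≈ᵇ m ⟧ * multinomial m v * (⟦ allPos (tail v) ⟧ * K v)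
  regroup v@(x ∷ xs) = trans (cong (_* (multinomial m v * K v)) (⟦∧⟧ (allPos xs) (vsum v ≈ᵇ m)))
                             (lemma ⟦ allPos xs ⟧ ⟦ vsum v ≈ᵇ m ⟧ (multinomial m v) (K v))

blockTerm : Vec ℕ (suc j) → Vec ℕ (suc j) → ℕ
blockTerm ms ns = ⟦ allPos (tail ms) ⟧ * (⟦ allPos (tail ns) ⟧ * prodTerm ms ns)

term-wordSum : ∀ m n j → term m n j ≡ wordSum (suc j) m (λ ms → wordSum (suc j) n (blockTerm ms))
term-wordSum m n j = begin
  term m n j
    ≡⟨ cong lsum (List.map-id (concatMap (λ ms → List.map (λ ns → multinomial m ms * multinomial n ns * prodTerm ms ns) (S n j)) (S m j))) ⟨
  sumOver (concatMap (λ ms → List.map (λ ns → multinomial m ms * multinomial n ns * prodTerm ms ns) (S n j)) (S m j)) id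
    ≡⟨ sumOver-concatMap (S m j) _ id ⟩
  sumOver (S m j) (λ ms → sumOver (List.map (λ ns → multinomial m ms * multinomial n ns * prodTerm ms ns) (S n j)) id)
    ≡⟨ sumOver-cong (S m j) (λ ms → trans (sumOver-map (S n j) _ id)
         (trans (sumOver-cong (S n j) (λ ns → *-assoc (multinomial m ms) (multinomial n ns) (prodTerm ms ns)))
           (sumOver-*ˡ (S n j) (multinomial m ms) (λ ns → multinomial n ns * prodTerm ms ns)))) ⟩
  sumOver (S m j) (λ ms → multinomial m ms * sumOver (S n j) (λ ns → multinomial n ns * prodTerm ms ns))
    ≡⟨ sumOver-cong (S m j) (λ ms → cong (multinomial m ms *_) (sumOver-S n j (prodTerm ms))) ⟩
  sumOver (S m j) (λ ms → multinomial m ms * wordSum (suc j) n (λ ns → ⟦ allPos (tail ns) ⟧ * prodTerm ms ns))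
    ≡⟨ sumOver-S m j _ ⟩
  wordSum (suc j) m (λ ms → ⟦ allPos (tail ms) ⟧ * wordSum (suc j) n (λ ns → ⟦ allPos (tail ns) ⟧ * prodTerm ms ns))
    ≡⟨ wordSum-cong (suc j) m (λ ms → sumOver-*ˡ (words (allFin (suc j)) n) ⟦ allPos (tail ms) ⟧ (λ q → ⟦ allPos (tail (content q)) ⟧ * prodTerm ms (content q))) ⟨
  wordSum (suc j) m (λ ms → wordSum (suc j) n (blockTerm ms)) ∎
  where open ≡-Reasoning

wordSum-one : ∀ m (H : Vec ℕ 1 → ℕ) → (∀ v → H v ≡ 1) → wordSum 1 m H ≡ 1
wordSum-one zero    H eq = cong (_+ 0) (eq _)
wordSum-one (suc m) H eq = trans (wordSum-suc 1 m H) (trans (+-identityʳ _) (wordSum-one m (λ v → H (updateAt v zero suc)) (λ v → eq _)))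

-- A single label allows one word for the rows and one for the columns, with an empty product of
-- blocks. This is the leading 1 of the formula.
term-zero : ∀ m n → term m n 0 ≡ 1
term-zero m n = trans (term-wordSum m n 0)
  (wordSum-one m (λ ms → wordSum 1 n (blockTerm ms)) (λ { (x ∷ []) → wordSum-one n (blockTerm (x ∷ [])) (λ { (y ∷ []) → refl }) }))

formula-sum : ∀ m n → sumOver (upTo (suc (m ⊓ n))) (term m n) ≡ lonesumFormula m n
formula-sum m n = trans (sumOver-upTo (m ⊓ n) (term m n))
  (cong (_+ sumOver (upTo (m ⊓ n)) (term m n ∘ suc)) (term-zero m n))

-- Admissible markings for given labels

map-zipWith : ∀ {A B C D : Set} {n} (f : C → D) (g : A → B → C) (xs : Vec A n) (ys : Vec B n) →
              map f (zipWith g xs ys) ≡ zipWith (λ x y → f (g x y)) xs ys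
map-zipWith f g []       []       = refl
map-zipWith f g (x ∷ xs) (y ∷ ys) = cong (f (g x y) ∷_) (map-zipWith f g xs ys)

zipWith-cong : ∀ {A B C : Set} {n} {f g : A → B → C} → (∀ x y → f x y ≡ g x y) →
               (xs : Vec A n) (ys : Vec B n) → zipWith f xs ys ≡ zipWith g xs ys
zipWith-cong eq []       []       = refl
zipWith-cong eq (x ∷ xs) (y ∷ ys) = cong₂ _∷_ (eq x y) (zipWith-cong eq xs ys)

conj : Vec Bool k → Bool
conj = foldr _ _∧_ true

⟦conj⟧ : (v : Vec Bool k) → ⟦ conj v ⟧ ≡ vprod (map ⟦_⟧ v)
⟦conj⟧ []      = refl
⟦conj⟧ (b ∷ v) = trans (⟦∧⟧ b (conj v)) (cong (⟦ b ⟧ *_) (⟦conj⟧ v))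

properMarks : Vec ℕ (suc j) → Vec ℕ (suc j) → Bool
properMarks (a ∷ as) (b ∷ bs) = isZero b ∧ (isZero a ∧ conj (zipWith isStar as (reverse bs)))

-- With the column tally fixed, the indicator is a constant times a product over the row labels, the
-- form that `sumOver-marks` can sum.
⟦properMarks⟧ : (a b : Vec ℕ (suc j)) →
  ⟦ properMarks a b ⟧ ≡ ⟦ isZero (head b) ⟧ * weight (⟦_⟧ ∘ isZero ∷ map (λ y x → ⟦ isStar x y ⟧) (reverse (tail b))) a
⟦properMarks⟧ (a ∷ as) (b ∷ bs) = begin
  ⟦ isZero b ∧ (isZero a ∧ conj (zipWith isStar as (reverse bs))) ⟧
    ≡⟨ trans (⟦∧⟧ (isZero b) _) (cong (⟦ isZero b ⟧ *_) (trans (⟦∧⟧ (isZero a) _) (cong (⟦ isZero a ⟧ *_) (⟦conj⟧ (zipWith isStar as (reverse bs)))))) ⟩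
  ⟦ isZero b ⟧ * (⟦ isZero a ⟧ * vprod (map ⟦_⟧ (zipWith isStar as (reverse bs))))
    ≡⟨ cong (λ z → ⟦ isZero b ⟧ * (⟦ isZero a ⟧ * vprod z)) (trans (map-zipWith ⟦_⟧ isStar as (reverse bs))
         (sym (Vec.zipWith-map₂ (λ x h → h x) (λ y x → ⟦ isStar x y ⟧) as (reverse bs)))) ⟩
  ⟦ isZero b ⟧ * weight (⟦_⟧ ∘ isZero ∷ map (λ y x → ⟦ isStar x y ⟧) (reverse bs)) (a ∷ as) ∎
  where open ≡-Reasoning

-- `sumOver-marks` acts twice: over row marks it turns each star indicator into a function of the
-- column tally alone, again a product over labels, and over column marks it then produces one `f3`
-- per block.
sumOver-properMarks : (p : Vec (Fin (suc j)) m) (q : Vec (Fin (suc j)) n) →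
  sumOver (words bools n) (λ u → sumOver (words bools m) (λ w → ⟦ properMarks (tally p w) (tally q u) ⟧)) ≡
  prodTerm (content p) (content q)
sumOver-properMarks {j} {m} {n} p q = begin
  sumOver (words bools n) (λ u → sumOver (words bools m) (λ w → ⟦ properMarks (tally p w) (tally q u) ⟧))
    ≡⟨ sumOver-cong (words bools n) (λ u → rowMarks (tally q u)) ⟩
  sumOver (words bools n) (λ u → weight (⟦_⟧ ∘ isZero ∷ map starsʳ (reverse cs)) (tally q u))
    ≡⟨ sumOver-marks-zipWith starsʳ (⟦_⟧ ∘ isZero) q (reverse cs) ⟩
  weight (pascal (⟦_⟧ ∘ isZero) ∷ map (pascal ∘ starsʳ) (reverse cs)) (content q)
    ≡⟨ colMarks (content p) (content q) ⟩
  prodTerm (content p) (content q) ∎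
  where
  open ≡-Reasoning
  cs : Vec ℕ j
  cs = tail (content p)
  starsˡ starsʳ : ℕ → ℕ → ℕ
  starsˡ y x = ⟦ isStar x y ⟧
  starsʳ r y = pascal (starsˡ y) r
  rowMarks : (b : Vec ℕ (suc j)) → sumOver (words bools m) (λ w → ⟦ properMarks (tally p w) b ⟧) ≡
                                   weight (⟦_⟧ ∘ isZero ∷ map starsʳ (reverse cs)) b
  rowMarks (b₀ ∷ bs) = begin
    sumOver (words bools m) (λ w → ⟦ properMarks (tally p w) (b₀ ∷ bs) ⟧)
      ≡⟨ sumOver-cong (words bools m) (λ w → ⟦properMarks⟧ (tally p w) (b₀ ∷ bs)) ⟩
    sumOver (words bools m) (λ w → ⟦ isZero b₀ ⟧ * weight (⟦_⟧ ∘ isZero ∷ map starsˡ (reverse bs)) (tally p w))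
      ≡⟨ sumOver-*ˡ (words bools m) ⟦ isZero b₀ ⟧ _ ⟩
    ⟦ isZero b₀ ⟧ * sumOver (words bools m) (λ w → weight (⟦_⟧ ∘ isZero ∷ map starsˡ (reverse bs)) (tally p w))
      ≡⟨ cong (⟦ isZero b₀ ⟧ *_) (trans (sumOver-marks-zipWith starsˡ (⟦_⟧ ∘ isZero) p (reverse bs)) (go (content p))) ⟩
    ⟦ isZero b₀ ⟧ * vprod (zipWith (λ y h → h y) bs (map starsʳ (reverse cs))) ∎
    where
    go : (c : Vec ℕ (suc j)) → weight (pascal (⟦_⟧ ∘ isZero) ∷ map (pascal ∘ starsˡ) (reverse bs)) c ≡
                               vprod (zipWith (λ y h → h y) bs (map starsʳ (reverse (tail c))))
    go (c₀ ∷ c) = begin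
      pascal (⟦_⟧ ∘ isZero) c₀ * vprod (zipWith (λ x h → h x) c (map (pascal ∘ starsˡ) (reverse bs)))
        ≡⟨ cong₂ _*_ (pascal-isZero c₀) (cong vprod (Vec.zipWith-map₂ (λ x h → h x) (pascal ∘ starsˡ) c (reverse bs))) ⟩
      1 * vprod (zipWith (λ x y → starsʳ x y) c (reverse bs))
        ≡⟨ *-identityˡ _ ⟩
      vprod (zipWith (λ x y → starsʳ x y) c (reverse bs))
        ≡⟨ vprod-flip starsʳ c bs ⟩
      vprod (zipWith (λ y x → starsʳ x y) bs (reverse c))
        ≡⟨ cong vprod (Vec.zipWith-map₂ (λ y h → h y) starsʳ bs (reverse c)) ⟨
      vprod (zipWith (λ y h → h y) bs (map starsʳ (reverse c))) ∎
  colMarks : (c d : Vec ℕ (suc j)) → weight (pascal (⟦_⟧ ∘ isZero) ∷ map (pascal ∘ starsʳ) (reverse (tail c))) d ≡ prodTerm c d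
  colMarks (c₀ ∷ c) (d₀ ∷ d) = begin
    pascal (⟦_⟧ ∘ isZero) d₀ * vprod (zipWith (λ y h → h y) d (map (pascal ∘ starsʳ) (reverse c)))
      ≡⟨ cong₂ _*_ (pascal-isZero d₀) (cong vprod (Vec.zipWith-map₂ (λ y h → h y) (pascal ∘ starsʳ) d (reverse c))) ⟩
    1 * vprod (zipWith (λ s r → pascal (starsʳ r) s) d (reverse c))
      ≡⟨ *-identityˡ _ ⟩
    vprod (zipWith (λ s r → pascal (starsʳ r) s) d (reverse c))
      ≡⟨ vprod-flip (λ s r → pascal (starsʳ r) s) d c ⟩
    vprod (zipWith (λ r s → pascal (starsʳ r) s) c (reverse d))
      ≡⟨ cong vprod (zipWith-cong pascal-isStar c (reverse d)) ⟩
    vprod (zipWith f3 c (reverse d)) ∎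

-- Enumerating the matrices

-- The retraction recovers from an element the index of its sublist, so sublists with distinct
-- indices are disjoint.
unique-concatMap : {xs : List A} (f : A → List B) (r : B → A) → (∀ x {y} → y ∈ f x → r y ≡ x) →
                   (∀ x → Unique (f x)) → Unique xs → Unique (concatMap f xs)
unique-concatMap f r retract uf []       = []
unique-concatMap f r retract uf (x∉ ∷ u) = Unique.++⁺ (uf _) (unique-concatMap f r retract uf u)
  λ (p , q) → let _ , y∈ , v∈fy = find (∈-concatMap⁻ f q) in
    All.lookup x∉ y∈ (trans (sym (retract _ p)) (retract _ v∈fy))

pairs : {B : A → Set} → List A → (∀ x → List (B x)) → List (Σ A B)
pairs xs ys = concatMap (λ x → List.map (x ,_) (ys x)) xs

sumOver-pairs : {B : A → Set} (xs : List A) (ys : ∀ x → List (B x)) (f : Σ A B → ℕ) →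
                sumOver (pairs xs ys) f ≡ sumOver xs (λ x → sumOver (ys x) (λ y → f (x , y)))
sumOver-pairs xs ys f = trans (sumOver-concatMap xs _ f) (sumOver-cong xs (λ x → sumOver-map (ys x) (x ,_) f))

unique-pairs : {B : A → Set} {xs : List A} {ys : ∀ x → List (B x)} →
               Unique xs → (∀ x → Unique (ys x)) → Unique (pairs xs ys)
unique-pairs {ys = ys} ux uy = unique-concatMap _ proj₁
  (λ x p → let _ , _ , eq = ∈-map⁻ (x ,_) p in cong proj₁ eq) (λ x → Unique.map⁺ (λ { refl → refl }) (uy x)) ux

∈-pairs : {B : A → Set} {xs : List A} {ys : ∀ x → List (B x)} {x : A} {y : B x} →
          x ∈ xs → y ∈ ys x → (x , y) ∈ pairs xs ys
∈-pairs {x = x} x∈ y∈ = ∈-concatMap⁺ _ (lose x∈ (∈-map⁺ (x ,_) y∈))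

unique-words : {xs : List A} → Unique xs → ∀ n → Unique (words xs n)
unique-words u zero    = [] ∷ []
unique-words u (suc n) = unique-concatMap _ head
  (λ x p → let _ , _ , eq = ∈-map⁻ (x ∷_) p in cong head eq) (λ x → Unique.map⁺ Vec.∷-injectiveʳ (unique-words u n)) u

∈-words : {xs : List A} → (∀ x → x ∈ xs) → (v : Vec A n) → v ∈ words xs n
∈-words x∈ []      = here refl
∈-words x∈ (x ∷ v) = ∈-concatMap⁺ _ (lose (x∈ x) (∈-map⁺ (x ∷_) (∈-words x∈ v)))

-- Injectivity is asked only on `P` because `decode` identifies some ill-formed codes, for instance
-- those that differ in a mark on a row of label 0.
unique-map : {P : A → Set} {f : A → B} → (∀ {x y} → P x → P y → f x ≡ f y → x ≡ y) →
             {xs : List A} → All P xs → Unique xs → Unique (List.map f xs)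
unique-map inj []         []       = []
unique-map inj (px ∷ pxs) (x∉ ∷ u) =
  All.map⁺ (All.zipWith (λ (py , x≢y) eq → x≢y (inj px py eq)) (pxs , x∉)) ∷ unique-map inj pxs u

bools-complete : ∀ b → b ∈ bools
bools-complete false = here refl
bools-complete true  = there (here refl)

bools-unique : Unique bools
bools-unique = ((λ ()) ∷ []) ∷ [] ∷ []

-- The row marks come last so that they form the innermost sum, as in `sumOver-properMarks`.
Code : ℕ → ℕ → Set
Code m n = Σ ℕ λ j → Σ (Vec (Fin (suc j)) m) λ p → Σ (Vec (Fin (suc j)) n) λ q → Σ (Vec Bool n) λ u → Vec Bool m

codes : ∀ m n → List (Code m n)
codes m n = pairs (upTo (suc (m ⊓ n))) λ j → pairs (words (allFin (suc j)) m) λ p →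
            pairs (words (allFin (suc j)) n) λ q → pairs (words bools n) λ u → words bools m

codes-unique : ∀ m n → Unique (codes m n)
codes-unique m n =
  unique-pairs (Unique.upTo⁺ (suc (m ⊓ n))) λ j →
  unique-pairs (unique-words (Unique.allFin⁺ (suc j)) m) λ p →
  unique-pairs (unique-words (Unique.allFin⁺ (suc j)) n) λ q →
  unique-pairs (unique-words bools-unique n) λ u → unique-words bools-unique m

codes-complete : j ≤ m ⊓ n → ∀ p q u w → (j , p , q , u , w) ∈ codes m n
codes-complete j≤ p q u w = ∈-pairs (∈-upTo⁺ (s≤s j≤)) (∈-pairs (∈-words ∈-allFin p) (∈-pairs (∈-words ∈-allFin q)
  (∈-pairs (∈-words bools-complete u) (∈-words bools-complete w))))

wellFormed : Code m n → Bool
wellFormed (j , p , q , u , w) =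
  allPos (tail (content p)) ∧ (allPos (tail (content q)) ∧ properMarks (tally p w) (tally q u))

countCodes : ∀ m n → length (filterᵇ wellFormed (codes m n)) ≡ lonesumFormula m n
countCodes m n = begin
  length (filterᵇ wellFormed (codes m n))
    ≡⟨ length-filterᵇ wellFormed (codes m n) ⟩
  sumOver (codes m n) (⟦_⟧ ∘ wellFormed)
    ≡⟨ sumOver-pairs (upTo (suc (m ⊓ n))) labels (⟦_⟧ ∘ wellFormed) ⟩
  sumOver (upTo (suc (m ⊓ n))) (λ j → sumOver (labels j) (λ c → ⟦ wellFormed (j , c) ⟧))
    ≡⟨ sumOver-cong (upTo (suc (m ⊓ n))) (λ j → trans (perHeight j) (sym (term-wordSum m n j))) ⟩
  sumOver (upTo (suc (m ⊓ n))) (term m n)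
    ≡⟨ formula-sum m n ⟩
  lonesumFormula m n ∎
  where
  open ≡-Reasoning
  marks : List (Σ (Vec Bool n) λ u → Vec Bool m)
  marks = pairs (words bools n) λ u → words bools m
  colLabels : ∀ j → List (Σ (Vec (Fin (suc j)) n) λ q → Σ (Vec Bool n) λ u → Vec Bool m)
  colLabels j = pairs (words (allFin (suc j)) n) λ q → marks
  labels : ∀ j → List (Σ (Vec (Fin (suc j)) m) λ p → Σ (Vec (Fin (suc j)) n) λ q → Σ (Vec Bool n) λ u → Vec Bool m)
  labels j = pairs (words (allFin (suc j)) m) λ p → colLabels j
  perLabels : ∀ {j} (p : Vec (Fin (suc j)) m) (q : Vec (Fin (suc j)) n) →
              sumOver marks (λ c → ⟦ wellFormed (j , p , q , c) ⟧) ≡ blockTerm (content p) (content q)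
  perLabels p q = begin
    sumOver marks (λ c → ⟦ P ∧ (Q ∧ proper c) ⟧)
      ≡⟨ sumOver-cong marks (λ c → trans (⟦∧⟧ P (Q ∧ proper c)) (cong (⟦ P ⟧ *_) (⟦∧⟧ Q (proper c)))) ⟩
    sumOver marks (λ c → ⟦ P ⟧ * (⟦ Q ⟧ * ⟦ proper c ⟧))
      ≡⟨ trans (sumOver-*ˡ marks ⟦ P ⟧ (λ c → ⟦ Q ⟧ * ⟦ proper c ⟧)) (cong (⟦ P ⟧ *_) (sumOver-*ˡ marks ⟦ Q ⟧ (⟦_⟧ ∘ proper))) ⟩
    ⟦ P ⟧ * (⟦ Q ⟧ * sumOver marks (⟦_⟧ ∘ proper))
      ≡⟨ cong (λ x → ⟦ P ⟧ * (⟦ Q ⟧ * x)) (trans (sumOver-pairs (words bools n) _ (⟦_⟧ ∘ proper)) (sumOver-properMarks p q)) ⟩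
    blockTerm (content p) (content q) ∎
    where
    P Q : Bool
    P = allPos (tail (content p))
    Q = allPos (tail (content q))
    proper : Σ (Vec Bool n) (λ u → Vec Bool m) → Bool
    proper (u , w) = properMarks (tally p w) (tally q u)
  perHeight : ∀ j → sumOver (labels j) (λ c → ⟦ wellFormed (j , c) ⟧) ≡
                    wordSum (suc j) m (λ ms → wordSum (suc j) n (blockTerm ms))
  perHeight j = trans (sumOver-pairs (words (allFin (suc j)) m) _ _) (sumOver-cong (words (allFin (suc j)) m) λ p →
                trans (sumOver-pairs (words (allFin (suc j)) n) _ _) (sumOver-cong (words (allFin (suc j)) n) (perLabels p)))

-- From codes to matrices

paint : ℕ → ℕ → Bool → ℕ
paint j s b with <-cmp s (suc j)
paint j s b     | tri< _ _ _ = 0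
paint j s true  | tri≈ _ _ _ = 1
paint j s false | tri≈ _ _ _ = 2
paint j s b     | tri> _ _ _ = 2

paint<3 : ∀ j s b → paint j s b < 3
paint<3 j s b with <-cmp s (suc j)
paint<3 j s b     | tri< _ _ _ = s≤s z≤n
paint<3 j s true  | tri≈ _ _ _ = s≤s (s≤s z≤n)
paint<3 j s false | tri≈ _ _ _ = ≤-refl
paint<3 j s b     | tri> _ _ _ = ≤-refl

paint-positive : ∀ j s b → 0 < paint j s b → j < s
paint-positive j s b pos with <-cmp s (suc j)
... | tri≈ _ eq _ = ≤-reflexive (sym eq)
... | tri> _ _ gt = <-trans (n<1+n j) gt

paint-positive⁻ : ∀ j s b → j < s → 0 < paint j s b
paint-positive⁻ j s b j<s with <-cmp s (suc j)
paint-positive⁻ j s b     j<s | tri< s≤j _ _ = contradiction (≤-<-trans (s≤s⁻¹ s≤j) j<s) (<-irrefl refl)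
paint-positive⁻ j s true  j<s | tri≈ _ _ _ = z<s
paint-positive⁻ j s false j<s | tri≈ _ _ _ = z<s
paint-positive⁻ j s b     j<s | tri> _ _ _ = z<s

paint-one : ∀ j s b → paint j s b ≡ 1 → s ≡ suc j × T b
paint-one j s b eq with <-cmp s (suc j)
paint-one j s true eq | tri≈ _ s≡ _ = s≡ , tt

paint-one⁻ : ∀ j s b → s ≡ suc j → T b → paint j s b ≡ 1
paint-one⁻ j s b s≡ t with <-cmp s (suc j)
paint-one⁻ j s b    s≡ t | tri< _ s≢ _ = contradiction s≡ s≢
paint-one⁻ j s true s≡ t | tri≈ _ _ _  = refl
paint-one⁻ j s b    s≡ t | tri> _ s≢ _ = contradiction s≡ s≢

painting : Code m n → Fin m → Fin n → ℕ
painting (j , p , q , u , w) i c = paint j (toℕ (lookup p i) + toℕ (lookup q c)) (lookup w i ∧ lookup u c)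

decode : Code m n → TMatrix m n
decode x = fromEntries (painting x) (λ i c → paint<3 _ _ _)

IsLayout : Code m n → Set
IsLayout (j , p , q , u , w) = Layout j (toℕ ∘ lookup p) (toℕ ∘ lookup q) (lookup w) (lookup u)

IsDepicted : Code m n → (Fin m → Fin n → ℕ) → Set
IsDepicted (j , p , q , u , w) = Depicts j (toℕ ∘ lookup p) (toℕ ∘ lookup q) (lookup w) (lookup u)

decode-depicts : (x : Code m n) → IsDepicted x (entry (decode x))
decode-depicts x@(j , p , q , u , w) = record
  { positive  = λ {i} {c} pos → paint-positive j _ _ (subst (0 <_) (entry≡ i c) pos)
  ; positive⁻ = λ {i} {c} lt → subst (0 <_) (sym (entry≡ i c)) (paint-positive⁻ j _ _ lt)
  ; one       = λ {i} {c} eq → let s≡ , t = paint-one j _ _ (trans (sym (entry≡ i c)) eq) in s≡ , Equivalence.to T-∧ t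
  ; one⁻      = λ {i} {c} s≡ μi νc → trans (entry≡ i c) (paint-one⁻ j _ _ s≡ (Equivalence.from T-∧ (μi , νc)))
  }
  where
  entry≡ : ∀ i c → entry (decode x) i c ≡ painting x i c
  entry≡ = entry-fromEntries (painting x) (λ i c → paint<3 _ _ _)

-- A depiction fixes the places of the 0s and of the 1s; entries below 3 leave only 2 elsewhere.
depicts-unique : ∀ {j} {X : Fin m → ℕ} {Y : Fin n → ℕ} {μ ν f g} → (∀ i c → f i c < 3) → (∀ i c → g i c < 3) →
                 Depicts j X Y μ ν f → Depicts j X Y μ ν g → ∀ i c → f i c ≡ g i c
depicts-unique {f = f} {g} f<3 g<3 D E i c with f i c in f≡ | g i c in g≡
... | 0 | 0 = refl
... | 0 | suc b = contradiction (subst (0 <_) f≡ (D.positive⁻ (E.positive (subst (0 <_) (sym g≡) z<s)))) λ ()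
  where module D = Depicts D
        module E = Depicts E
... | suc a | 0 = contradiction (subst (0 <_) g≡ (E.positive⁻ (D.positive (subst (0 <_) (sym f≡) z<s)))) λ ()
  where module D = Depicts D
        module E = Depicts E
... | 1 | suc b = let s≡ , μi , νc = Depicts.one D f≡ in trans (sym (Depicts.one⁻ E s≡ μi νc)) g≡
... | suc (suc a) | 1 = let s≡ , μi , νc = Depicts.one E g≡ in trans (sym f≡) (Depicts.one⁻ D s≡ μi νc)
... | suc (suc a) | suc (suc b) = cong (λ x → suc (suc x)) (trans (small f≡ (f<3 i c)) (sym (small g≡ (g<3 i c))))
  where
  small : ∀ {x y} → x ≡ suc (suc y) → x < 3 → y ≡ 0
  small refl (s≤s (s≤s (s≤s z≤n))) = refl

decode-injective : {x y : Code m n} → IsLayout x → IsLayout y → decode x ≡ decode y → x ≡ y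
decode-injective {x = x@(j , p , q , u , w)} {y = y@(j′ , p′ , q′ , u′ , w′)} L L′ eq =
  assemble (height-unique L D L′ D′) (rowLabels-unique L D L′ D′)
    (rowLabels-unique (flipLayout L) (flipDepicts D) (flipLayout L′) (flipDepicts D′))
    (lookup-ext (rowMarks-unique (flipLayout L) (flipDepicts D) (flipLayout L′) (flipDepicts D′)))
    (lookup-ext (rowMarks-unique L D L′ D′))
  where
  D : IsDepicted x (entry (decode x))
  D = decode-depicts x
  D′ : IsDepicted y (entry (decode x))
  D′ = subst (λ M → IsDepicted y (entry M)) (sym eq) (decode-depicts y)
  -- The heights are identified before the labels, whose type `Fin (suc j)` depends on them.
  assemble : j ≡ j′ → (∀ i → toℕ (lookup p i) ≡ toℕ (lookup p′ i)) → (∀ c → toℕ (lookup q c) ≡ toℕ (lookup q′ c)) →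
             u ≡ u′ → w ≡ w′ → x ≡ y
  assemble refl p≡ q≡ refl refl with lookup-ext {xs = p} {p′} (Fin.toℕ-injective ∘ p≡) | lookup-ext {xs = q} {q′} (Fin.toℕ-injective ∘ q≡)
  ... | refl | refl = refl

-- Well-formed codes and layouts

bump-view : ∀ (t′ t : Fin k) b v →
            (T b × t′ ≡ t × lookup (bump b t′ v) t ≡ suc (lookup v t)) ⊎
            (¬ (T b × t′ ≡ t) × lookup (bump b t′ v) t ≡ lookup v t)
bump-view t′ t false v = inj₂ ((λ ()) , refl)
bump-view t′ t true  v with t Fin.≟ t′
... | yes refl = inj₁ (tt , refl , Vec.lookup∘updateAt t v)
... | no  t≢t′ = inj₂ ((λ (_ , eq) → t≢t′ (sym eq)) , Vec.lookup∘updateAt′ t t′ t≢t′ v)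

module _ {t : Fin k} where

  tally-pos : (p : Vec (Fin k) m) (w : Vec Bool m) → ∀ i → T (lookup w i) → lookup p i ≡ t → 0 < lookup (tally p w) t
  tally-pos (t′ ∷ p) (b ∷ w) zero    wi pi with bump-view t′ t b (tally p w)
  ... | inj₁ (_ , _ , eq) = subst (0 <_) (sym eq) z<s
  ... | inj₂ (miss , _)   = contradiction (wi , pi) miss
  tally-pos (t′ ∷ p) (b ∷ w) (suc i) wi pi with bump-view t′ t b (tally p w)
  ... | inj₁ (_ , _ , eq) = subst (0 <_) (sym eq) z<s
  ... | inj₂ (_ , eq)     = subst (0 <_) (sym eq) (tally-pos p w i wi pi)

  tally-pos⁻ : (p : Vec (Fin k) m) (w : Vec Bool m) → 0 < lookup (tally p w) t → ∃[ i ] T (lookup w i) × lookup p i ≡ t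
  tally-pos⁻ []       []      pos = contradiction (subst (0 <_) (Vec.lookup-replicate t 0) pos) λ ()
  tally-pos⁻ (t′ ∷ p) (b ∷ w) pos with bump-view t′ t b (tally p w)
  ... | inj₁ (wi , pi , _) = zero , wi , pi
  ... | inj₂ (_ , eq)      = let i , wi , pi = tally-pos⁻ p w (subst (0 <_) eq pos) in suc i , wi , pi

  tally-two : (p : Vec (Fin k) m) (w : Vec Bool m) → ∀ {i i′} → i ≢ i′ → T (lookup w i) → T (lookup w i′) →
              lookup p i ≡ t → lookup p i′ ≡ t → 1 < lookup (tally p w) t
  tally-two (t′ ∷ p) (b ∷ w) {i} {i′} i≢i′ wi wi′ pi pi′ with bump-view t′ t b (tally p w) | i | i′
  ... | _ | zero | zero = contradiction refl i≢i′
  ... | inj₁ (_ , _ , eq) | zero  | suc r = subst (1 <_) (sym eq) (s≤s (tally-pos p w r wi′ pi′))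
  ... | inj₁ (_ , _ , eq) | suc r | _     = subst (1 <_) (sym eq) (s≤s (tally-pos p w r wi pi))
  ... | inj₂ (miss , _)   | zero  | _     = contradiction (wi , pi) miss
  ... | inj₂ (miss , _)   | suc r | zero  = contradiction (wi′ , pi′) miss
  ... | inj₂ (_ , eq)     | suc r | suc s = subst (1 <_) (sym eq) (tally-two p w (i≢i′ ∘ cong suc) wi wi′ pi pi′)

  tally-two⁻ : (p : Vec (Fin k) m) (w : Vec Bool m) → 1 < lookup (tally p w) t →
               ∃[ i ] ∃[ i′ ] i ≢ i′ × (T (lookup w i) × lookup p i ≡ t) × (T (lookup w i′) × lookup p i′ ≡ t)
  tally-two⁻ []       []      two = contradiction (subst (1 <_) (Vec.lookup-replicate t 0) two) λ ()
  tally-two⁻ (t′ ∷ p) (b ∷ w) two with bump-view t′ t b (tally p w)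
  ... | inj₁ (wi , pi , eq) = let i′ , r = tally-pos⁻ p w (s≤s⁻¹ (subst (1 <_) eq two)) in
                              zero , suc i′ , (λ ()) , (wi , pi) , r
  ... | inj₂ (_ , eq)       = let i , i′ , i≢i′ , r , s = tally-two⁻ p w (subst (1 <_) eq two) in
                              suc i , suc i′ , i≢i′ ∘ Fin.suc-injective , r , s

  content-pos : (p : Vec (Fin k) m) → ∀ i → lookup p i ≡ t → 0 < lookup (content p) t
  content-pos p i = tally-pos p (replicate _ true) i (subst T (sym (Vec.lookup-replicate i true)) tt)

  content-pos⁻ : (p : Vec (Fin k) m) → 0 < lookup (content p) t → ∃[ i ] lookup p i ≡ t
  content-pos⁻ p pos = let i , _ , pi = tally-pos⁻ p (replicate _ true) pos in i , pi

allPos⁺ : (v : Vec ℕ k) → (∀ t → 0 < lookup v t) → T (allPos v)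
allPos⁺ []      pos = tt
allPos⁺ (x ∷ v) pos = Equivalence.from T-∧ (≤⇒≤ᵇ (pos zero) , allPos⁺ v (pos ∘ suc))

allPos⁻ : (v : Vec ℕ k) → T (allPos v) → ∀ t → 0 < lookup v t
allPos⁻ (x ∷ v) pos zero    = ≤ᵇ⇒≤ 1 x (proj₁ (Equivalence.to T-∧ pos))
allPos⁻ (x ∷ v) pos (suc t) = allPos⁻ v (proj₂ (Equivalence.to (T-∧ {1 ≤ᵇ x}) pos)) t

lookup-tail : (v : Vec A (suc k)) → ∀ t → lookup (tail v) t ≡ lookup v (suc t)
lookup-tail (x ∷ v) t = refl

conj⁺ : (v : Vec Bool k) → (∀ t → T (lookup v t)) → T (conj v)
conj⁺ []      h = tt
conj⁺ (b ∷ v) h = Equivalence.from T-∧ (h zero , conj⁺ v (h ∘ suc))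

conj⁻ : (v : Vec Bool k) → T (conj v) → ∀ t → T (lookup v t)
conj⁻ (b ∷ v) h zero    = proj₁ (Equivalence.to T-∧ h)
conj⁻ (b ∷ v) h (suc t) = conj⁻ v (proj₂ (Equivalence.to (T-∧ {b}) h)) t

lookup-∷ʳ-inject₁ : (v : Vec A k) (x : A) → ∀ t → lookup (v ∷ʳ x) (inject₁ t) ≡ lookup v t
lookup-∷ʳ-inject₁ (y ∷ v) x zero    = refl
lookup-∷ʳ-inject₁ (y ∷ v) x (suc t) = lookup-∷ʳ-inject₁ v x t

lookup-∷ʳ-fromℕ : (v : Vec A k) (x : A) → lookup (v ∷ʳ x) (fromℕ k) ≡ x
lookup-∷ʳ-fromℕ []      x = refl
lookup-∷ʳ-fromℕ (y ∷ v) x = lookup-∷ʳ-fromℕ v x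

lookup-reverse-opposite : (v : Vec A k) → ∀ t → lookup (reverse v) (opposite t) ≡ lookup v t
lookup-reverse-opposite (x ∷ v) zero    rewrite Vec.reverse-∷ x v = lookup-∷ʳ-fromℕ (reverse v) x
lookup-reverse-opposite (x ∷ v) (suc t) rewrite Vec.reverse-∷ x v =
  trans (lookup-∷ʳ-inject₁ (reverse v) x (opposite t)) (lookup-reverse-opposite v t)

lookup-reverse : (v : Vec A k) → ∀ t → lookup (reverse v) t ≡ lookup v (opposite t)
lookup-reverse v t = trans (cong (lookup (reverse v)) (sym (Fin.opposite-involutive t))) (lookup-reverse-opposite v (opposite t))

isZero⁺ : ∀ {a} → ¬ (0 < a) → T (isZero a)
isZero⁺ {zero}  _  = tt
isZero⁺ {suc a} ¬p = ¬p z<s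

isZero⁻ : ∀ {a} → T (isZero a) → ¬ (0 < a)
isZero⁻ {zero} _ = λ ()

-- The star condition in the terms of a layout: the first two fields express the existence of
-- partners, the last one `thin`.
record StarCounts (a b : ℕ) : Set where
  field
    pos→ : 0 < a → 0 < b
    pos← : 0 < b → 0 < a
    one  : 1 < a → 1 < b → ⊥

isStar⁺ : ∀ {a b} → StarCounts a b → T (isStar a b)
isStar⁺ {zero}        {zero}        s = tt
isStar⁺ {zero}        {suc b}       s = contradiction (StarCounts.pos← s z<s) λ ()
isStar⁺ {suc a}       {zero}        s = contradiction (StarCounts.pos→ s z<s) λ ()
isStar⁺ {suc zero}    {suc b}       s = tt
isStar⁺ {suc (suc a)} {suc zero}    s = tt
isStar⁺ {suc (suc a)} {suc (suc b)} s = StarCounts.one s (s≤s z<s) (s≤s z<s)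

isStar⁻ : ∀ {a b} → T (isStar a b) → StarCounts a b
isStar⁻ {zero}        {zero}     t = record { pos→ = id ; pos← = id ; one = λ () }
isStar⁻ {suc zero}    {suc b}    t = record { pos→ = λ _ → z<s ; pos← = λ _ → z<s ; one = λ { (s≤s ()) } }
isStar⁻ {suc (suc a)} {suc zero} t = record { pos→ = λ _ → z<s ; pos← = λ _ → z<s ; one = λ { _ (s≤s ()) } }

record ProperMarks {j} (a b : Vec ℕ (suc j)) : Set where
  field
    row₀  : ¬ (0 < lookup a zero)
    col₀  : ¬ (0 < lookup b zero)
    stars : ∀ t → StarCounts (lookup a (suc t)) (lookup b (suc (opposite t)))

lookup-block : (as bs : Vec ℕ k) → ∀ t →
               lookup (zipWith isStar as (reverse bs)) t ≡ isStar (lookup as t) (lookup bs (opposite t))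
lookup-block as bs t = trans (Vec.lookup-zipWith isStar t as (reverse bs)) (cong (isStar (lookup as t)) (lookup-reverse bs t))

properMarks⁺ : (a b : Vec ℕ (suc j)) → ProperMarks a b → T (properMarks a b)
properMarks⁺ (a ∷ as) (b ∷ bs) P = Equivalence.from T-∧ (isZero⁺ col₀ , Equivalence.from T-∧ (isZero⁺ row₀ ,
  conj⁺ (zipWith isStar as (reverse bs)) λ t → subst T (sym (lookup-block as bs t)) (isStar⁺ (stars t))))
  where open ProperMarks P

properMarks⁻ : (a b : Vec ℕ (suc j)) → T (properMarks a b) → ProperMarks a b
properMarks⁻ (a ∷ as) (b ∷ bs) h = record
  { row₀  = isZero⁻ (proj₁ (Equivalence.to T-∧ h′))
  ; col₀  = isZero⁻ (proj₁ (Equivalence.to T-∧ h))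
  ; stars = λ t → isStar⁻ (subst T (lookup-block as bs t) (conj⁻ (zipWith isStar as (reverse bs)) (proj₂ (Equivalence.to (T-∧ {isZero a}) h′)) t))
  }
  where
  h′ : T (isZero a ∧ conj (zipWith isStar as (reverse bs)))
  h′ = proj₂ (Equivalence.to (T-∧ {isZero b}) h)

-- This reconciles the two descriptions of diagonal partners, by `reverse` in the product and by
-- label sum `j + 1` in a layout.
opposite-sum : (t : Fin j) → suc (toℕ t) + suc (toℕ (opposite t)) ≡ suc j
opposite-sum {j} t = cong suc (trans (+-suc (toℕ t) (toℕ (opposite t)))
  (trans (cong (suc (toℕ t) +_) (Fin.opposite-prop t)) (m+[n∸m]≡n (Fin.toℕ<n t))))

diagonal⁺ : {x y : Fin (suc j)} (t : Fin j) → x ≡ suc t → y ≡ suc (opposite t) → toℕ x + toℕ y ≡ suc j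
diagonal⁺ t refl refl = opposite-sum t

diagonalʳ : {x y : Fin (suc j)} (t : Fin j) → toℕ x + toℕ y ≡ suc j → x ≡ suc t → y ≡ suc (opposite t)
diagonalʳ t sum≡ refl = Fin.toℕ-injective (+-cancelˡ-≡ (suc (toℕ t)) _ _ (trans sum≡ (sym (opposite-sum t))))

diagonalˡ : {x y : Fin (suc j)} (t : Fin j) → toℕ x + toℕ y ≡ suc j → y ≡ suc (opposite t) → x ≡ suc t
diagonalˡ t sum≡ refl = Fin.toℕ-injective (+-cancelʳ-≡ (suc (toℕ (opposite t))) _ _ (trans sum≡ (sym (opposite-sum t))))

diagonal⁻ : {x y : Fin (suc j)} → toℕ x + toℕ y ≡ suc j → ∃[ t ] x ≡ suc t
diagonal⁻ {x = zero}  {y} sum≡ = contradiction (subst (_< suc _) sum≡ (Fin.toℕ<n y)) (<-irrefl refl)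
diagonal⁻ {x = suc t} {y} sum≡ = t , refl

module _ {j : ℕ} (p : Vec (Fin (suc j)) m) where

  onto⁺ : T (allPos (tail (content p))) → ∀ t → t < j → ∃[ i ] toℕ (lookup p i) ≡ suc t
  onto⁺ pos t t<j =
    let i , pi = content-pos⁻ p (subst (0 <_) (lookup-tail (content p) (fromℕ< t<j)) (allPos⁻ (tail (content p)) pos (fromℕ< t<j)))
    in i , trans (cong toℕ pi) (cong suc (Fin.toℕ-fromℕ< t<j))

  onto⁻ : (∀ t → t < j → ∃[ i ] toℕ (lookup p i) ≡ suc t) → T (allPos (tail (content p)))
  onto⁻ onto = allPos⁺ (tail (content p)) λ t → let i , eq = onto (toℕ t) (Fin.toℕ<n t) in
    subst (0 <_) (sym (lookup-tail (content p) t)) (content-pos p i (Fin.toℕ-injective eq))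

label≤ : (p : Vec (Fin (suc j)) m) → ∀ i → toℕ (lookup p i) ≤ j
label≤ p i = s≤s⁻¹ (Fin.toℕ<n (lookup p i))

wellFormed⇒layout : (x : Code m n) → T (wellFormed x) → IsLayout x
wellFormed⇒layout (j , p , q , u , w) h = record
  { X≤j = label≤ p ; Y≤j = label≤ q
  ; X-onto = onto⁺ p (proj₁ hp) ; Y-onto = onto⁺ q (proj₁ hq)
  ; partnerˣ = partnerˣ ; partnerʸ = partnerʸ
  ; thin = λ {i} {i′} {c} {c′} i≢i′ c≢c′ μi μi′ νc νc′ ic i′c ic′ →
      let t , pi = diagonal⁻ {x = lookup p i} {lookup q c} ic
          qc = diagonalʳ t ic pi
      in StarCounts.one (stars t) (tally-two p w i≢i′ μi μi′ pi (diagonalˡ t i′c qc))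
                                  (tally-two q u c≢c′ νc νc′ qc (diagonalʳ t ic′ pi))
  }
  where
  hp : T (allPos (tail (content p))) × T (allPos (tail (content q)) ∧ properMarks (tally p w) (tally q u))
  hp = Equivalence.to T-∧ h
  hq : T (allPos (tail (content q))) × T (properMarks (tally p w) (tally q u))
  hq = Equivalence.to T-∧ (proj₂ hp)
  open ProperMarks (properMarks⁻ (tally p w) (tally q u) (proj₂ hq))
  partnerˣ : ∀ i → T (lookup w i) → ∃[ c ] T (lookup u c) × toℕ (lookup p i) + toℕ (lookup q c) ≡ suc j
  partnerˣ i μi with lookup p i in pi
  ... | zero  = contradiction (tally-pos p w i μi pi) row₀
  ... | suc t = let c , νc , qc = tally-pos⁻ q u (StarCounts.pos→ (stars t) (tally-pos p w i μi pi)) in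
                c , νc , diagonal⁺ t refl qc
  partnerʸ : ∀ c → T (lookup u c) → ∃[ i ] T (lookup w i) × toℕ (lookup p i) + toℕ (lookup q c) ≡ suc j
  partnerʸ c νc with lookup q c in qc
  ... | zero  = contradiction (tally-pos q u c νc qc) col₀
  -- `stars` is indexed by row labels, so the column label is first rewritten as the opposite of a
  -- row label.
  ... | suc s = let t = opposite s
                    s≡ = cong suc (sym (Fin.opposite-involutive s))
                    i , μi , pi = tally-pos⁻ p w (StarCounts.pos← (stars t) (tally-pos q u c νc (trans qc s≡)))
                in i , μi , diagonal⁺ t pi s≡

layout⇒wellFormed : (x : Code m n) → IsLayout x → T (wellFormed x)
layout⇒wellFormed (j , p , q , u , w) L = Equivalence.from T-∧ (onto⁻ p X-onto , Equivalence.from T-∧ (onto⁻ q Y-onto ,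
  properMarks⁺ (tally p w) (tally q u) (record { row₀ = row₀ ; col₀ = col₀ ; stars = stars })))
  where
  open Layout L
  row₀ : ¬ (0 < lookup (tally p w) zero)
  row₀ pos = let i , μi , pi = tally-pos⁻ p w pos
                 c , _ , sum≡ = partnerˣ i μi
             in contradiction (trans (sym pi) (proj₂ (diagonal⁻ {x = lookup p i} {lookup q c} sum≡))) λ ()
  col₀ : ¬ (0 < lookup (tally q u) zero)
  col₀ pos = let c , νc , qc = tally-pos⁻ q u pos
                 i , _ , sum≡ = partnerʸ c νc
                 sum≡′ = trans (+-comm (toℕ (lookup q c)) (toℕ (lookup p i))) sum≡
             in contradiction (trans (sym qc) (proj₂ (diagonal⁻ {x = lookup q c} {lookup p i} sum≡′))) λ ()
  stars : ∀ t → StarCounts (lookup (tally p w) (suc t)) (lookup (tally q u) (suc (opposite t)))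
  stars t = record
    { pos→ = λ pos → let i , μi , pi = tally-pos⁻ p w pos
                         c , νc , sum≡ = partnerˣ i μi
                     in tally-pos q u c νc (diagonalʳ t sum≡ pi)
    ; pos← = λ pos → let c , νc , qc = tally-pos⁻ q u pos
                         i , μi , sum≡ = partnerʸ c νc
                     in tally-pos p w i μi (diagonalˡ t sum≡ qc)
    ; one  = λ two two′ →
        let i , i′ , i≢i′ , (μi , pi) , (μi′ , pi′) = tally-two⁻ p w two
            c , c′ , c≢c′ , (νc , qc) , (νc′ , qc′) = tally-two⁻ q u two′
        in thin i≢i′ c≢c′ μi μi′ νc νc′ (diagonal⁺ t pi qc) (diagonal⁺ t pi′ qc) (diagonal⁺ t pi qc′)
    }

-- From switch-free matrices to codes

module _ {j : ℕ} {X X′ : Fin m → ℕ} {Y Y′ : Fin n → ℕ} {μ μ′ : Fin m → Bool} {ν ν′ : Fin n → Bool}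
         (X≗ : ∀ i → X i ≡ X′ i) (Y≗ : ∀ c → Y c ≡ Y′ c) (μ≗ : ∀ i → μ i ≡ μ′ i) (ν≗ : ∀ c → ν c ≡ ν′ c) where
  private
    sum⇒ : ∀ {i c s} → X i + Y c ≡ s → X′ i + Y′ c ≡ s
    sum⇒ {i} {c} = trans (sym (cong₂ _+_ (X≗ i) (Y≗ c)))
    sum⇐ : ∀ {i c s} → X′ i + Y′ c ≡ s → X i + Y c ≡ s
    sum⇐ {i} {c} = trans (cong₂ _+_ (X≗ i) (Y≗ c))
    row⇒ : ∀ {i} → T (μ i) → T (μ′ i)
    row⇒ {i} = subst T (μ≗ i)
    row⇐ : ∀ {i} → T (μ′ i) → T (μ i)
    row⇐ {i} = subst T (sym (μ≗ i))
    col⇒ : ∀ {c} → T (ν c) → T (ν′ c)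
    col⇒ {c} = subst T (ν≗ c)
    col⇐ : ∀ {c} → T (ν′ c) → T (ν c)
    col⇐ {c} = subst T (sym (ν≗ c))

  -- The analysis produces functions, a code stores tabulated vectors, and the two agree only
  -- pointwise.
  layout-resp : Layout j X Y μ ν → Layout j X′ Y′ μ′ ν′
  layout-resp L = record
    { X≤j = λ i → subst (_≤ j) (X≗ i) (X≤j i)
    ; Y≤j = λ c → subst (_≤ j) (Y≗ c) (Y≤j c)
    ; X-onto = λ t t<j → let i , eq = X-onto t t<j in i , trans (sym (X≗ i)) eq
    ; Y-onto = λ t t<j → let c , eq = Y-onto t t<j in c , trans (sym (Y≗ c)) eq
    ; partnerˣ = λ i μi → let c , νc , eq = partnerˣ i (row⇐ μi) in c , col⇒ νc , sum⇒ eq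
    ; partnerʸ = λ c νc → let i , μi , eq = partnerʸ c (col⇐ νc) in i , row⇒ μi , sum⇒ eq
    ; thin = λ i≢i′ c≢c′ μi μi′ νc νc′ ic i′c ic′ →
        thin i≢i′ c≢c′ (row⇐ μi) (row⇐ μi′) (col⇐ νc) (col⇐ νc′) (sum⇐ ic) (sum⇐ i′c) (sum⇐ ic′)
    }
    where open Layout L

  depicts-resp : ∀ {f} → Depicts j X Y μ ν f → Depicts j X′ Y′ μ′ ν′ f
  depicts-resp D = record
    { positive  = λ {i} {c} pos → subst (j <_) (cong₂ _+_ (X≗ i) (Y≗ c)) (positive pos)
    ; positive⁻ = λ {i} {c} lt → positive⁻ (subst (j <_) (sym (cong₂ _+_ (X≗ i) (Y≗ c))) lt)
    ; one       = λ eq → let s≡ , μi , νc = one eq in sum⇒ s≡ , row⇒ μi , col⇒ νc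
    ; one⁻      = λ s≡ μi νc → one⁻ (sum⇐ s≡) (row⇐ μi) (col⇐ νc)
    }
    where open Depicts D

-- Choosing a line for each positive label is injective. Applied to rows and columns, this bounds
-- the height by `m ⊓ n`, the range of the sum.
onto⇒≤ : ∀ {j} (X : Fin m → ℕ) → (∀ t → t < j → ∃[ i ] X i ≡ suc t) → j ≤ m
onto⇒≤ {j = j} X onto = Fin.injective⇒≤ {f = choose} λ {s} {t} eq → Fin.toℕ-injective
  (suc-injective (trans (sym (spec s)) (trans (cong X eq) (spec t))))
  where
  choose : Fin j → Fin _
  choose t = proj₁ (onto (toℕ t) (Fin.toℕ<n t))
  spec : ∀ t → X (choose t) ≡ suc (toℕ t)
  spec t = proj₂ (onto (toℕ t) (Fin.toℕ<n t))

module Encode (M : TMatrix m n) (noSwitch : NoSwitch (entry M)) where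

  open Analysis (entry M) (entry<3 M) noSwitch

  code : Code m n
  code = height , tabulate (λ i → fromℕ< (s≤s (X≤j i))) , tabulate (λ c → fromℕ< (s≤s (Y≤j c))) , tabulate ν , tabulate μ

  X≗ : ∀ i → X i ≡ toℕ (lookup (tabulate (λ i → fromℕ< (s≤s (X≤j i)))) i)
  X≗ i = sym (trans (cong toℕ (Vec.lookup∘tabulate _ i)) (Fin.toℕ-fromℕ< (s≤s (X≤j i))))

  Y≗ : ∀ c → Y c ≡ toℕ (lookup (tabulate (λ c → fromℕ< (s≤s (Y≤j c)))) c)
  Y≗ c = sym (trans (cong toℕ (Vec.lookup∘tabulate _ c)) (Fin.toℕ-fromℕ< (s≤s (Y≤j c))))

  code-layout : IsLayout code
  code-layout = layout-resp X≗ Y≗ (sym ∘ Vec.lookup∘tabulate μ) (sym ∘ Vec.lookup∘tabulate ν) layout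

  code-depicts : IsDepicted code (entry M)
  code-depicts = depicts-resp X≗ Y≗ (sym ∘ Vec.lookup∘tabulate μ) (sym ∘ Vec.lookup∘tabulate ν) depicts

  code∈codes : code ∈ codes m n
  code∈codes = codes-complete (⊓-glb (onto⇒≤ X X-onto) (onto⇒≤ Y Y-onto)) _ _ _ _

  decode-code : M ≡ decode code
  decode-code = entry-ext M (decode code)
    (depicts-unique (entry<3 M) (entry<3 (decode code)) code-depicts (decode-depicts code))

theorem3p5 : (m n : ℕ) → .{{_ : NonZero m}} → .{{_ : NonZero n}} →
    HasCount (IsLonesum {m} {n}) (lonesumFormula m n)
theorem3p5 m n =
    List.map decode good
  , unique-map (λ {x} {y} wx wy → decode-injective (wellFormed⇒layout x wx) (wellFormed⇒layout y wy))
      (All.all-filter (T? ∘ wellFormed) (codes m n)) (Unique.filter⁺ (T? ∘ wellFormed) (codes-unique m n))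
  , (λ M → mk⇔ (sound M) (complete M))
  , trans (List.length-map decode good) (countCodes m n)
  where
  good : List (Code m n)
  good = filterᵇ wellFormed (codes m n)
  sound : ∀ M → M ∈ List.map decode good → IsLonesum M
  sound M M∈ with ∈-map⁻ decode M∈
  ... | x , x∈ , refl = noSwitch⇒lonesum (decode x) (layout⇒noSwitch
          (wellFormed⇒layout x (proj₂ (∈-filter⁻ (T? ∘ wellFormed) {xs = codes m n} x∈))) (decode-depicts x))
  complete : ∀ M → IsLonesum M → M ∈ List.map decode good
  complete M lonesum = subst (_∈ List.map decode good) (sym decode-code)
    (∈-map⁺ decode (∈-filter⁺ (T? ∘ wellFormed) code∈codes (layout⇒wellFormed code code-layout)))
    where open Encode M (lonesum⇒noSwitch M lonesum)
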